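{- Let $F=\mathbb Q(\sqrt5)$. The elements $\sigma,\nu,\tau$ generate $\Gamma^*$, and a complete set of defining relations for $\Gamma^*$ in these generators is (i$'$) $\sigma^2=1$; (ii$'$) $(\sigma\tau)^3=1$; (iii$'$) $(\sigma\nu)^2=1$; (iv$'$) $\tau\nu\tau\nu^{ -1}=\nu\tau\nu^{ -1}\tau$; (v$'$) $\nu^2\tau\nu^{ -2}=\tau\nu\tau\nu^{ -1}$.
   Context: Let $F=\mathbb Q(\sqrt5)$, $\mathcal O_F$ its ring of integers, $E_F$ its unit group and $\epsilon=(1+\sqrt5)/2$. Let $Z=\{uI_2:u\in E_F\}$, $\bar\Gamma^*=\{\gamma\in\mathrm{GL}(2,\mathcal O_F):\det\gamma=\epsilon^n,n\in\mathbb Z\}$ and $\Gamma^*=Z\bar\Gamma^*/Z\subset\mathrm{PGL}(2,\mathcal O_F)$. Let $\sigma,\nu,\tau\in\Gamma^*$ be the images of $\begin{pmatrix}0&1\\-1&0\end{pmatrix}$, $\begin{pmatrix}\epsilon&0\\0&1\end{pmatrix}$, $\begin{pmatrix}1&1\\0&1\end{pmatrix}$. -}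

module Defs where

open import Data.Integer using (ℤ; +_; -[1+_]; _+_; _*_; -_)
open import Data.Nat using (ℕ; zero; suc)
open import Data.List using (List; []; _∷_; _++_)
open import Data.Product using (Σ; _×_; _,_)
open import Relation.Binary.PropositionalEquality using (_≡_)

-- The ring of integers O_F of F = ℚ(√5) is ℤ[ε], ε = (1+√5)/2, ε² = ε + 1.
-- An element  a + b ε  is represented by  mkO a b.

record OF : Set where
  constructor mkO
  field
    re : ℤ
    im : ℤ

open OF public

zeroO oneO εO εinvO : OF
zeroO = mkO (+ 0) (+ 0)
oneO  = mkO (+ 1) (+ 0)
εO    = mkO (+ 0) (+ 1)
εinvO = mkO (- (+ 1)) (+ 1)

infixl 6 _+O_
infixl 7 _*O_

_+O_ : OF → OF → OF
mkO a b +O mkO c d = mkO (a + c) (b + d)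

-O_ : OF → OF
-O mkO a b = mkO (- a) (- b)

_*O_ : OF → OF → OF
mkO a b *O mkO c d = mkO (a * c + b * d) (a * d + b * c + b * d)

_^O_ : OF → ℕ → OF
x ^O zero  = oneO
x ^O suc n = x *O (x ^O n)

εpow : ℤ → OF
εpow (+ n)     = εO ^O n
εpow -[1+ n ]  = εinvO ^O suc n

IsUnit : OF → Set
IsUnit u = Σ OF (λ v → u *O v ≡ oneO)

record Mat : Set where
  constructor mat
  field
    m11 m12 m21 m22 : OF

open Mat public

_·_ : Mat → Mat → Mat
mat a b c d · mat e f g h =
  mat (a *O e +O b *O g) (a *O f +O b *O h)
      (c *O e +O d *O g) (c *O f +O d *O h)

I₂ : Mat
I₂ = mat oneO zeroO zeroO oneO

det : Mat → OF
det (mat a b c d) = a *O d +O -O (b *O c)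

scale : OF → Mat → Mat
scale u (mat a b c d) = mat (u *O a) (u *O b) (u *O c) (u *O d)

-- membership in  Γ̄* = { γ ∈ GL(2,O_F) : det γ = ε^n, n ∈ ℤ }
-- (det a unit already implies invertibility over O_F)
InΓ̄* : Mat → Set
InΓ̄* γ = Σ ℤ (λ n → det γ ≡ εpow n)

-- equality in Γ* = Z Γ̄* / Z : equal up to a scalar unit matrix
_≈Γ_ : Mat → Mat → Set
A ≈Γ B = Σ OF (λ u → IsUnit u × (A ≡ scale u B))

data Gen : Set where
  σ ν τ : Gen

data Letter : Set where
  g⁺ : Gen → Letter
  g⁻ : Gen → Letter

Word : Set
Word = List Letter

genMat : Gen → Mat
genMat σ = mat zeroO oneO (-O oneO) zeroO
genMat ν = mat εO zeroO zeroO oneO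
genMat τ = mat oneO oneO zeroO oneO

genMatInv : Gen → Mat
genMatInv σ = mat zeroO (-O oneO) oneO zeroO
genMatInv ν = mat εinvO zeroO zeroO oneO
genMatInv τ = mat oneO (-O oneO) zeroO oneO

letterMat : Letter → Mat
letterMat (g⁺ g) = genMat g
letterMat (g⁻ g) = genMatInv g

eval : Word → Mat
eval []       = I₂
eval (x ∷ w)  = letterMat x · eval w

-- The group presented by ⟨σ,ν,τ | (i')–(v')⟩: words modulo the
-- congruence generated by free cancellation and the relations.

s t n s⁻¹ t⁻¹ n⁻¹ : Letter
s = g⁺ σ ; t = g⁺ τ ; n = g⁺ ν
s⁻¹ = g⁻ σ ; t⁻¹ = g⁻ τ ; n⁻¹ = g⁻ ν

data BasicRel : Word → Word → Set where
  cancel⁺ : ∀ g → BasicRel (g⁺ g ∷ g⁻ g ∷ []) []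
  cancel⁻ : ∀ g → BasicRel (g⁻ g ∷ g⁺ g ∷ []) []
  rel1 : BasicRel (s ∷ s ∷ []) []
  rel2 : BasicRel (s ∷ t ∷ s ∷ t ∷ s ∷ t ∷ []) []
  rel3 : BasicRel (s ∷ n ∷ s ∷ n ∷ []) []
  rel4 : BasicRel (t ∷ n ∷ t ∷ n⁻¹ ∷ []) (n ∷ t ∷ n⁻¹ ∷ t ∷ [])
  rel5 : BasicRel (n ∷ n ∷ t ∷ n⁻¹ ∷ n⁻¹ ∷ []) (t ∷ n ∷ t ∷ n⁻¹ ∷ [])

data _~_ : Word → Word → Set where
  step  : ∀ x y {l r} → BasicRel l r → (x ++ l ++ y) ~ (x ++ r ++ y)
  ~refl : ∀ {w} → w ~ w
  ~sym  : ∀ {u v} → u ~ v → v ~ u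
  ~trans : ∀ {u v w} → u ~ v → v ~ w → u ~ w

{-# OPTIONS --safe #-}
module Submission where

-- Call |N c| the height of a matrix with first column (a , c).  The subgroup generated by ν and τ
-- preserves the height; by (iv') and (v') it is the semidirect product of the translations by O_F
-- with ⟨ν⟩.  O_F is norm-Euclidean, so subtracting a multiple of c from a and applying σ lowers the
-- height, and every matrix is the value of a word along which the heights decrease.  It remains to
-- see that two such words for the same matrix are equivalent.  They begin with quotients x and y
-- such that |N (a / c − x)| < 1 and |N (a / c − y)| < 1.  If x − y is a unit, the two lower matrices
-- are joined by an edge as well, and (i'), (ii'), (iii') together with induction on the height give
-- the equivalence.  In general x and y are joined by a chain of such quotients with unit
-- differences: take integers nearest to the numbers εᵏ a / c and multiply them by ε⁻ᵏ; consecutive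
-- ones differ by an element whose norm is less than 4 in absolute value, and O_F has no elements of
-- norm ±2 or ±3.

open import Defs renaming (_~_ to infix 4 _~_; _≈Γ_ to infix 4 _≈Γ_)
open import Algebra.Bundles using (CommutativeRing)
open import Data.Empty using (⊥-elim)
open import Data.Integer as ℤ using (ℤ; +_; -[1+_]; _+_; _*_; -_; ∣_∣; _≤_; _<_; +≤+; _/ℕ_; _%ℕ_)
open import Data.Integer.Divisibility.Signed as Signed using (∣m+n∣m⇒∣n; ∣m⇒∣m*n; ∣⇒∣ᵤ; ∣ᵤ⇒∣)
open import Data.Integer.DivMod using (a≡a%ℕn+[a/ℕn]*n; n%ℕd<d)
open import Data.Integer.Properties as ℤ using ()
open import Data.Integer.Solver using (module +-*-Solver)
open import Data.List using ([]; _∷_; _++_)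
open import Data.Maybe using (just; nothing)
open import Data.Nat as ℕ using (ℕ; zero; suc; z≤n; s≤s)
open import Data.Nat.Divisibility using (_∣_; _∣?_; divides; ∣-reflexive; ∣⇒≤)
open import Data.Nat.Induction using (<-wellFounded)
open import Data.Nat.Properties as ℕ using ()
open import Data.Product using (Σ; _×_; _,_; proj₁; proj₂)
open import Data.Sum as Sum using (_⊎_; inj₁; inj₂)
open import Induction.WellFounded using (Acc; acc)
open import Level using (0ℓ)
open import Relation.Binary.Bundles using (Setoid)
open import Relation.Binary.Definitions using (Tri; tri<; tri≈; tri>)
open import Relation.Binary.PropositionalEquality
open import Relation.Nullary using (¬_; Dec; yes; no)
open import Relation.Nullary.Decidable using (from-no)
open import Tactic.RingSolver using (solve-∀)
open import Tactic.RingSolver.Core.AlmostCommutativeRing using (AlmostCommutativeRing; fromCommutativeRing)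
import Relation.Binary.Reasoning.Setoid as SetoidReasoning
open +-*-Solver using (solve; _:+_; _:*_; :-_; _:-_; _:=_; con; Polynomial)

-- The condition |N (a / c - x)| < 1 bounds only the product of the two conjugates of a / c - x, a
-- region that is unbounded in both directions, whereas (ii') speaks only of quotients that differ
-- by a unit. The trace form `q` restores a genuine distance. A suitable power of ε balances the two
-- conjugates, after which `q` is at most √5 times the absolute norm, and a quotient balanced at
-- some scale is equal or linked to the point rounded at that scale. Rounding leaves `q` ≤ 9/8 in
-- units of the squared denominator `M`, and every difference to be compared then has norm at most
-- 31/8, just below 4.
--
-- A second obstacle is an edge between two lower matrices of equal height, which σ neither raises
-- nor lowers. It is filled by a triangle through a still lower matrix, and for that reason the
-- rounding analysis admits quotients with |N (a / c - x)| = 1. Filling it uses uniqueness at that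
-- height, while uniqueness at height `h` uses such fillings below `h`, so the two facts share one
-- induction.

+O-assoc : ∀ x y z → (x +O y) +O z ≡ x +O (y +O z)
+O-assoc x y z = cong₂ mkO (ℤ.+-assoc (re x) (re y) (re z)) (ℤ.+-assoc (im x) (im y) (im z))

+O-comm : ∀ x y → x +O y ≡ y +O x
+O-comm x y = cong₂ mkO (ℤ.+-comm (re x) (re y)) (ℤ.+-comm (im x) (im y))

*O-comm : ∀ x y → x *O y ≡ y *O x
*O-comm (mkO a b) (mkO c d) = cong₂ mkO
  (solve 4 (λ a b c d → a :* c :+ b :* d := c :* a :+ d :* b) refl a b c d)
  (solve 4 (λ a b c d → a :* d :+ b :* c :+ b :* d := c :* b :+ d :* a :+ d :* b) refl a b c d)

*O-assoc : ∀ x y z → (x *O y) *O z ≡ x *O (y *O z)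
*O-assoc (mkO a b) (mkO c d) (mkO e f) = cong₂ mkO
  (solve 6 (λ a b c d e f →
      (a :* c :+ b :* d) :* e :+ (a :* d :+ b :* c :+ b :* d) :* f
      := a :* (c :* e :+ d :* f) :+ b :* (c :* f :+ d :* e :+ d :* f)) refl a b c d e f)
  (solve 6 (λ a b c d e f →
      (a :* c :+ b :* d) :* f :+ (a :* d :+ b :* c :+ b :* d) :* e :+ (a :* d :+ b :* c :+ b :* d) :* f
      := a :* (c :* f :+ d :* e :+ d :* f) :+ b :* (c :* e :+ d :* f) :+ b :* (c :* f :+ d :* e :+ d :* f)) refl a b c d e f)

*O-identityˡ : ∀ x → oneO *O x ≡ x
*O-identityˡ (mkO a b) = cong₂ mkO
  (solve 2 (λ a b → con (+ 1) :* a :+ con (+ 0) :* b := a) refl a b)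
  (solve 2 (λ a b → con (+ 1) :* b :+ con (+ 0) :* a :+ con (+ 0) :* b := b) refl a b)

*O-distribˡ : ∀ x y z → x *O (y +O z) ≡ x *O y +O x *O z
*O-distribˡ (mkO a b) (mkO c d) (mkO e f) = cong₂ mkO
  (solve 6 (λ a b c d e f → a :* (c :+ e) :+ b :* (d :+ f) := a :* c :+ b :* d :+ (a :* e :+ b :* f)) refl a b c d e f)
  (solve 6 (λ a b c d e f → a :* (d :+ f) :+ b :* (c :+ e) :+ b :* (d :+ f)
      := a :* d :+ b :* c :+ b :* d :+ (a :* f :+ b :* e :+ b :* f)) refl a b c d e f)

O-commutativeRing : CommutativeRing 0ℓ 0ℓ
O-commutativeRing = record
  { Carrier = OF ; _≈_ = _≡_ ; _+_ = _+O_ ; _*_ = _*O_ ; -_ = -O_ ; 0# = zeroO ; 1# = oneO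
  ; isCommutativeRing = record
    { isRing = record
      { +-isAbelianGroup = record
        { isGroup = record
          { isMonoid = record
            { isSemigroup = record
              { isMagma = record { isEquivalence = isEquivalence ; ∙-cong = cong₂ _+O_ }
              ; assoc = +O-assoc }
            ; identity = +O-identityˡ , λ x → trans (+O-comm x zeroO) (+O-identityˡ x) }
          ; inverse = (λ x → trans (+O-comm (-O x) x) (+O-inverseʳ x)) , +O-inverseʳ
          ; ⁻¹-cong = cong -O_ }
        ; comm = +O-comm }
      ; *-cong = cong₂ _*O_
      ; *-assoc = *O-assoc
      ; *-identity = *O-identityˡ , λ x → trans (*O-comm x oneO) (*O-identityˡ x)
      ; distrib = *O-distribˡ , λ x y z → trans (*O-comm (y +O z) x)
          (trans (*O-distribˡ x y z) (cong₂ _+O_ (*O-comm x y) (*O-comm x z))) }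
    ; *-comm = *O-comm } }
  where
  +O-identityˡ : ∀ x → zeroO +O x ≡ x
  +O-identityˡ x = cong₂ mkO (ℤ.+-identityˡ _) (ℤ.+-identityˡ _)
  +O-inverseʳ : ∀ x → x +O (-O x) ≡ zeroO
  +O-inverseʳ x = cong₂ mkO (ℤ.+-inverseʳ (re x)) (ℤ.+-inverseʳ (im x))

O-ring : AlmostCommutativeRing 0ℓ 0ℓ
O-ring = fromCommutativeRing O-commutativeRing (λ { (mkO (+ 0) (+ 0)) → just refl ; _ → nothing })

-- Nonnegative integers

0≤_ : ℤ → Set
0≤ x = + 0 ≤ x

infix 4 0≤_

0≤-+ : ∀ {x y} → 0≤ x → 0≤ y → 0≤ x + y
0≤-+ (+≤+ _) (+≤+ _) = +≤+ z≤n

0≤-* : ∀ {x y} → 0≤ x → 0≤ y → 0≤ x * y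
0≤-* {+ a} {+ b} (+≤+ _) (+≤+ _) = subst 0≤_ (ℤ.pos-* a b) (+≤+ z≤n)

0≤-square : ∀ x → 0≤ x * x
0≤-square (+ a)    = subst 0≤_ (ℤ.pos-* a a) (+≤+ z≤n)
0≤-square -[1+ a ] = +≤+ z≤n

0≤-scale : ∀ k {x} → 0≤ x → 0≤ + k * x
0≤-scale k = 0≤-* {+ k} (+≤+ z≤n)

0≤-unscale : ∀ k x → 0≤ + suc k * x → 0≤ x
0≤-unscale k (+ a)    _ = +≤+ z≤n
0≤-unscale k -[1+ a ] ()

-- By integrality `x < 0` becomes `0≤ - x + - + 1`. Both alternatives can thus be multiplied and
-- added inside the polynomial identities that certify later inequalities.
0≤-split : ∀ x → 0≤ x ⊎ 0≤ - x + - + 1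
0≤-split (+ a)          = inj₁ (+≤+ z≤n)
0≤-split -[1+ zero ]    = inj₂ (+≤+ z≤n)
0≤-split -[1+ suc a ]   = inj₂ (+≤+ z≤n)

¬0≤-1 : ¬ (0≤ - + 1)
¬0≤-1 ()

∣_∣≤_ : ℤ → ℤ → Set
∣ v ∣≤ m = (0≤ m + - v) × (0≤ m + v)

infix 4 ∣_∣≤_

abs⇒bound : ∀ {v m} → ∣ v ∣ ℕ.≤ m → ∣ v ∣≤ + m
abs⇒bound {+ a} a≤m = ℤ.i≤j⇒0≤j-i (+≤+ a≤m) , +≤+ z≤n
abs⇒bound { -[1+ a ]} a≤m = +≤+ z≤n , ℤ.i≤j⇒0≤j-i (+≤+ a≤m)

bound⇒abs : ∀ {v m} → ∣ v ∣≤ + m → ∣ v ∣ ℕ.≤ m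
bound⇒abs {+ a} (p , _) = ℤ.drop‿+≤+ (ℤ.0≤i-j⇒j≤i p)
bound⇒abs { -[1+ a ]} (_ , p) = ℤ.drop‿+≤+ (ℤ.0≤i-j⇒j≤i {j = + suc a} p)

square≥1 : ∀ n → n ≢ + 0 → 0≤ n * n + - + 1
square≥1 (+ zero)  n≢0 = ⊥-elim (n≢0 refl)
square≥1 (+ suc k) _   = +≤+ z≤n
square≥1 -[1+ k ]  _   = +≤+ z≤n

-- Norm and trace form

N : OF → ℤ
N (mkO a b) = a * a + a * b + - (b * b)

-- q z = z² + z′² for the conjugate z′ of z.
q : OF → ℤ
q (mkO a b) = + 2 * (a * a) + + 2 * (a * b) + + 3 * (b * b)

module _ {m : ℕ} where
  Nᵖ qᵖ : Polynomial m → Polynomial m → Polynomial m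
  Nᵖ a b = a :* a :+ a :* b :+ :- (b :* b)
  qᵖ a b = con (+ 2) :* (a :* a) :+ con (+ 2) :* (a :* b) :+ con (+ 3) :* (b :* b)
  reᵖ imᵖ : Polynomial m → Polynomial m → Polynomial m → Polynomial m → Polynomial m
  reᵖ a b c d = a :* c :+ b :* d
  imᵖ a b c d = a :* d :+ b :* c :+ b :* d

N-* : ∀ x y → N (x *O y) ≡ N x * N y
N-* (mkO a b) (mkO c d) = solve 4 (λ a b c d →
  Nᵖ (reᵖ a b c d) (imᵖ a b c d) := Nᵖ a b :* Nᵖ c d) refl a b c d

N-neg : ∀ x → N (-O x) ≡ N x
N-neg (mkO a b) = solve 2 (λ a b → Nᵖ (:- a) (:- b) := Nᵖ a b) refl a b

∣N-*∣ : ∀ x y → ∣ N (x *O y) ∣ ≡ ∣ N x ∣ ℕ.* ∣ N y ∣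
∣N-*∣ x y = trans (cong ∣_∣ (N-* x y)) (ℤ.abs-* (N x) (N y))

∣N-ε*∣ : ∀ z → ∣ N (εO *O z) ∣ ≡ ∣ N z ∣
∣N-ε*∣ z = trans (∣N-*∣ εO z) (ℕ.+-identityʳ _)

∣N-ε⁻¹*∣ : ∀ z → ∣ N (εinvO *O z) ∣ ≡ ∣ N z ∣
∣N-ε⁻¹*∣ z = trans (∣N-*∣ εinvO z) (ℕ.+-identityʳ _)

ε-ε⁻¹ : ∀ z → εO *O (εinvO *O z) ≡ z
ε-ε⁻¹ = solve-∀ O-ring

ε⁻¹-ε : ∀ z → εinvO *O (εO *O z) ≡ z
ε⁻¹-ε = solve-∀ O-ring

2q≡squares : ∀ a b → + 2 * q (mkO a b) ≡ (+ 2 * a + b) * (+ 2 * a + b) + + 5 * (b * b)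
2q≡squares = solve 2 (λ a b → con (+ 2) :* qᵖ a b :=
  (con (+ 2) :* a :+ b) :* (con (+ 2) :* a :+ b) :+ con (+ 5) :* (b :* b)) refl

0≤q : ∀ z → 0≤ q z
0≤q (mkO a b) = 0≤-unscale 1 (q (mkO a b)) (subst 0≤_ (sym (2q≡squares a b))
  (0≤-+ (0≤-square (+ 2 * a + b)) (0≤-scale 5 (0≤-square b))))

-- With X = z² and Y = z′² both sides are 5 X Y − (X + Y)², so q z ≤ √5 |N z| whenever
-- z minimises q on its orbit {εᵏ z}.
q-step-identity : ∀ z → (q (εO *O z) + - q z) * (q (εinvO *O z) + - q z) ≡ + 5 * (N z * N z) + - (q z * q z)
q-step-identity (mkO a b) = solve 2 (λ a b →
  (qᵖ (reᵖ (con (+ 0)) (con (+ 1)) a b) (imᵖ (con (+ 0)) (con (+ 1)) a b) :+ :- qᵖ a b)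
  :* (qᵖ (reᵖ (con (- + 1)) (con (+ 1)) a b) (imᵖ (con (- + 1)) (con (+ 1)) a b) :+ :- qᵖ a b)
  := con (+ 5) :* (Nᵖ a b :* Nᵖ a b) :+ :- (qᵖ a b :* qᵖ a b)) refl a b

q-decreases : ∀ {y z} → 0≤ - (q y + - q z) + - + 1 → ∣ q y ∣ ℕ.< ∣ q z ∣
q-decreases {y} {z} p = ℤ.drop‿+<+ (subst₂ _<_ (sym (ℤ.0≤i⇒+∣i∣≡i (0≤q y))) (sym (ℤ.0≤i⇒+∣i∣≡i (0≤q z)))
  (ℤ.suc[i]≤j⇒i<j (ℤ.0≤i-j⇒j≤i (subst 0≤_
    (solve 2 (λ y z → :- (y :+ :- z) :+ :- con (+ 1) := z :+ :- (con (+ 1) :+ y)) refl (q y) (q z)) p))))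

-- Recursion on `q`: multiply by ε or its inverse as long as this makes `q` smaller. When neither
-- does, both factors in `q-step-identity` are nonnegative, which is the hypothesis of the base
-- case.
ε-induction : (P : OF → Set)
  → (∀ z → 0≤ + 5 * (N z * N z) + - (q z * q z) → P z)
  → (∀ z → P (εO *O z) → P z)
  → (∀ z → P (εinvO *O z) → P z)
  → ∀ z → P z
ε-induction P base up down z = go z (<-wellFounded _)
  where
  go : ∀ z → Acc ℕ._<_ ∣ q z ∣ → P z
  go z (acc rs) with 0≤-split (q (εO *O z) + - q z) | 0≤-split (q (εinvO *O z) + - q z)
  ... | inj₂ d | _ = up z (go _ (rs (q-decreases {εO *O z} {z} d)))
  ... | inj₁ _ | inj₂ d = down z (go _ (rs (q-decreases {εinvO *O z} {z} d)))
  ... | inj₁ u | inj₁ v = base z (subst 0≤_ (q-step-identity z) (0≤-* u v))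

-- If `b` were nonzero, 2 q = (2 a + b)² + 5 b² would be at least 5, against 4 q² ≤ 20 N² ≤ 20.
small⇒rational : ∀ z → 0≤ + 5 * (N z * N z) + - (q z * q z) → 0≤ + 1 + - (N z * N z) → im z ≡ + 0
small⇒rational z@(mkO a b) q²≤5N² N²≤1 with b ℤ.≟ + 0
... | yes b≡0 = b≡0
... | no b≢0 = ⊥-elim (¬0≤-1 (0≤-unscale 4 (- + 1) (subst 0≤_
      (solve 2 (λ q n → (con (+ 2) :* q :+ :- con (+ 5)) :* (con (+ 2) :* q :+ con (+ 5))
        :+ con (+ 4) :* (con (+ 5) :* (n :* n) :+ :- (q :* q))
        :+ con (+ 20) :* (con (+ 1) :+ :- (n :* n)) := con (+ 5) :* (:- con (+ 1))) refl (q z) (N z))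
      (0≤-+ (0≤-+ (0≤-* 2q≥5 (0≤-+ (0≤-scale 2 (0≤q z)) (+≤+ z≤n))) (0≤-scale 4 q²≤5N²)) (0≤-scale 20 N²≤1)))))
  where
  2q≥5 : 0≤ + 2 * q z + - + 5
  2q≥5 = subst 0≤_ (solve 2 (λ a b →
      (con (+ 2) :* a :+ b) :* (con (+ 2) :* a :+ b) :+ con (+ 5) :* (b :* b :+ :- con (+ 1))
      := con (+ 2) :* qᵖ a b :+ :- con (+ 5)) refl a b)
    (0≤-+ (0≤-square (+ 2 * a + b)) (0≤-scale 5 (square≥1 b b≢0)))

i*i≡0⇒i≡0 : ∀ i → i * i ≡ + 0 → i ≡ + 0
i*i≡0⇒i≡0 i p with ℤ.i*j≡0⇒i≡0∨j≡0 i p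
... | inj₁ i≡0 = i≡0
... | inj₂ i≡0 = i≡0

N-rational : ∀ a {b} → b ≡ + 0 → N (mkO a b) ≡ a * a
N-rational a refl = solve 1 (λ a → Nᵖ a (con (+ 0)) := a :* a) refl a

N≡0⇒≡0 : ∀ z → N z ≡ + 0 → z ≡ zeroO
N≡0⇒≡0 = ε-induction _ base
  (λ z ih Nz≡0 → trans (sym (ε⁻¹-ε z)) (cong (εinvO *O_) (ih (trans (N-* εO z) (cong (- + 1 *_) Nz≡0)))))
  (λ z ih Nz≡0 → trans (sym (ε-ε⁻¹ z)) (cong (εO *O_) (ih (trans (N-* εinvO z) (cong (- + 1 *_) Nz≡0)))))
  where
  base : ∀ z → 0≤ + 5 * (N z * N z) + - (q z * q z) → N z ≡ + 0 → z ≡ zeroO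
  base z@(mkO a b) q²≤5N² Nz≡0 =
    cong₂ mkO (i*i≡0⇒i≡0 a (trans (sym (N-rational a b≡0)) Nz≡0)) b≡0
    where
    b≡0 : b ≡ + 0
    b≡0 = small⇒rational z q²≤5N² (subst (λ m → 0≤ + 1 + - (m * m)) (sym Nz≡0) (+≤+ z≤n))

-- Small norms

module _ (p : ℕ) .{{_ : ℕ.NonZero p}} (1<p : 1 ℕ.< p)
  (anisotropic : ∀ {r s} → r ℕ.< p → s ℕ.< p → p ∣ ∣ N (mkO (+ r) (+ s)) ∣ → r ≡ 0 × s ≡ 0) where

  private
    multiple⇒p*p∣ : ∀ z → re z %ℕ p ≡ 0 → im z %ℕ p ≡ 0 → p ℕ.* p ∣ ∣ N z ∣
    multiple⇒p*p∣ (mkO a b) r≡0 s≡0 = divides ∣ N y ∣ (begin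
      ∣ N (mkO a b) ∣                            ≡⟨ cong₂ (λ a b → ∣ N (mkO a b) ∣) (quotient a r≡0) (quotient b s≡0) ⟩
      ∣ N (mkO (a /ℕ p * + p) (b /ℕ p * + p)) ∣  ≡⟨ cong ∣_∣ (N-multiple (a /ℕ p) (b /ℕ p) (+ p)) ⟩
      ∣ N y * (+ p * + p) ∣                      ≡⟨ ℤ.abs-* (N y) (+ p * + p) ⟩
      ∣ N y ∣ ℕ.* ∣ + p * + p ∣                  ≡⟨ cong (∣ N y ∣ ℕ.*_) (ℤ.abs-* (+ p) (+ p)) ⟩
      ∣ N y ∣ ℕ.* (p ℕ.* p)                      ∎)
      where
      open ≡-Reasoning
      y : OF
      y = mkO (a /ℕ p) (b /ℕ p)
      quotient : ∀ a → a %ℕ p ≡ 0 → a ≡ a /ℕ p * + p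
      quotient a r≡0 = trans (a≡a%ℕn+[a/ℕn]*n a p)
        (trans (cong (λ r → + r + a /ℕ p * + p) r≡0) (ℤ.+-identityˡ (a /ℕ p * + p)))
      N-multiple : ∀ u v p → N (mkO (u * p) (v * p)) ≡ N (mkO u v) * (p * p)
      N-multiple = solve 3 (λ u v p → Nᵖ (u :* p) (v :* p) := Nᵖ u v :* (p :* p)) refl

    p∣N⇒p∣N-residues : ∀ z → p ∣ ∣ N z ∣ → p ∣ ∣ N (mkO (+ (re z %ℕ p)) (+ (im z %ℕ p))) ∣
    p∣N⇒p∣N-residues (mkO a b) p∣N = ∣⇒∣ᵤ (reduce (+ (a %ℕ p)) (a /ℕ p) (+ (b %ℕ p)) (b /ℕ p) (+ p)
      (subst₂ (λ a b → + p Signed.∣ N (mkO a b)) (a≡a%ℕn+[a/ℕn]*n a p) (a≡a%ℕn+[a/ℕn]*n b p) (∣ᵤ⇒∣ p∣N)))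
      where
      cross : ℤ → ℤ → ℤ → ℤ → ℤ → ℤ
      cross r u r₂ v p = + 2 * (r * u) + r * v + u * r₂ + - (+ 2 * (r₂ * v)) + p * N (mkO u v)
      expand : ∀ r u r₂ v p → N (mkO (r + u * p) (r₂ + v * p)) ≡ p * cross r u r₂ v p + N (mkO r r₂)
      expand = solve 5 (λ r u s v p → Nᵖ (r :+ u :* p) (s :+ v :* p) := p :* (con (+ 2) :* (r :* u) :+ r :* v
           :+ u :* s :+ :- (con (+ 2) :* (s :* v)) :+ p :* Nᵖ u v) :+ Nᵖ r s) refl
      reduce : ∀ r u r₂ v p → p Signed.∣ N (mkO (r + u * p) (r₂ + v * p)) → p Signed.∣ N (mkO r r₂)
      reduce r u r₂ v p d = ∣m+n∣m⇒∣n {m = p * cross r u r₂ v p} (subst (p Signed.∣_) (expand r u r₂ v p) d)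
        (∣m⇒∣m*n (cross r u r₂ v p) Signed.∣-refl)

  -- When the norm form has no nontrivial zero modulo `p`, divisibility of `N z` by `p` forces both
  -- coordinates to be divisible by `p`, and then p² divides `N z`.
  inert⇒∣N∣≢ : ∀ z → ∣ N z ∣ ≢ p
  inert⇒∣N∣≢ z ∣N∣≡p = ℕ.<⇒≱ (ℕ.m<m*n p p 1<p) (∣⇒≤ (subst (p ℕ.* p ∣_) ∣N∣≡p
      (multiple⇒p*p∣ z (proj₁ residues) (proj₂ residues))))
    where
    residues : re z %ℕ p ≡ 0 × im z %ℕ p ≡ 0
    residues = anisotropic (n%ℕd<d (re z) p) (n%ℕd<d (im z) p) (p∣N⇒p∣N-residues z (∣-reflexive (sym ∣N∣≡p)))

∣N∣≢2 : ∀ z → ∣ N z ∣ ≢ 2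
∣N∣≢2 = inert⇒∣N∣≢ 2 (s≤s (s≤s z≤n)) anisotropic
  where
  anisotropic : ∀ {r s} → r ℕ.< 2 → s ℕ.< 2 → 2 ∣ ∣ N (mkO (+ r) (+ s)) ∣ → r ≡ 0 × s ≡ 0
  anisotropic {0} {0} _ _ _ = refl , refl
  anisotropic {0} {1} _ _ d = ⊥-elim (from-no (2 ∣? 1) d)
  anisotropic {1} {0} _ _ d = ⊥-elim (from-no (2 ∣? 1) d)
  anisotropic {1} {1} _ _ d = ⊥-elim (from-no (2 ∣? 1) d)
  anisotropic {suc (suc _)} (s≤s (s≤s ()))
  anisotropic {_} {suc (suc _)} _ (s≤s (s≤s ()))

∣N∣≢3 : ∀ z → ∣ N z ∣ ≢ 3
∣N∣≢3 = inert⇒∣N∣≢ 3 (s≤s (s≤s z≤n)) anisotropic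
  where
  anisotropic : ∀ {r s} → r ℕ.< 3 → s ℕ.< 3 → 3 ∣ ∣ N (mkO (+ r) (+ s)) ∣ → r ≡ 0 × s ≡ 0
  anisotropic {0} {0} _ _ _ = refl , refl
  anisotropic {0} {1} _ _ d = ⊥-elim (from-no (3 ∣? 1) d)
  anisotropic {0} {2} _ _ d = ⊥-elim (from-no (3 ∣? 4) d)
  anisotropic {1} {0} _ _ d = ⊥-elim (from-no (3 ∣? 1) d)
  anisotropic {1} {1} _ _ d = ⊥-elim (from-no (3 ∣? 1) d)
  anisotropic {1} {2} _ _ d = ⊥-elim (from-no (3 ∣? 1) d)
  anisotropic {2} {0} _ _ d = ⊥-elim (from-no (3 ∣? 4) d)
  anisotropic {2} {1} _ _ d = ⊥-elim (from-no (3 ∣? 5) d)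
  anisotropic {2} {2} _ _ d = ⊥-elim (from-no (3 ∣? 4) d)
  anisotropic {suc (suc (suc _))} (s≤s (s≤s (s≤s ())))
  anisotropic {_} {suc (suc (suc _))} _ (s≤s (s≤s (s≤s ())))

∣N∣≤3⇒zero⊎unit : ∀ z → ∣ N z ∣ ℕ.≤ 3 → z ≡ zeroO ⊎ ∣ N z ∣ ≡ 1
∣N∣≤3⇒zero⊎unit z le with ∣ N z ∣ in eq
... | 0 = inj₁ (N≡0⇒≡0 z (ℤ.∣i∣≡0⇒i≡0 eq))
... | 1 = inj₂ refl
... | 2 = ⊥-elim (∣N∣≢2 z eq)
... | 3 = ⊥-elim (∣N∣≢3 z eq)
∣N∣≤3⇒zero⊎unit z (s≤s (s≤s (s≤s ()))) | suc (suc (suc (suc _)))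

-- Nearest integers

division⇒nearest : ∀ m d r e → m ≡ r + e * d → 0≤ d → 0≤ r → 0≤ d + - r
  → Σ ℤ λ x → 0≤ d * d + - (+ 4 * ((m + - (d * x)) * (m + - (d * x))))
division⇒nearest m d r e refl 0≤d 0≤r r≤d with 0≤-split (d + - (+ 2 * r))
... | inj₁ 2r≤d = e , subst 0≤_
      (solve 3 (λ d r e → (d :+ :- (con (+ 2) :* r)) :* (d :+ con (+ 2) :* r)
          := d :* d :+ :- (con (+ 4) :* ((r :+ e :* d :+ :- (d :* e)) :* (r :+ e :* d :+ :- (d :* e))))) refl d r e)
      (0≤-* 2r≤d (0≤-+ 0≤d (0≤-scale 2 0≤r)))
... | inj₂ 2r>d = + 1 + e , subst 0≤_
      (solve 3 (λ d r e → (con (+ 2) :* (d :+ :- r) :+ d) :* (:- (d :+ :- (con (+ 2) :* r)) :+ :- con (+ 1) :+ con (+ 1))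
          := d :* d :+ :- (con (+ 4) :* ((r :+ e :* d :+ :- (d :* (con (+ 1) :+ e))) :* (r :+ e :* d :+ :- (d :* (con (+ 1) :+ e))))))
          refl d r e)
      (0≤-* (0≤-+ (0≤-scale 2 r≤d) 0≤d) (0≤-+ 2r>d (+≤+ z≤n)))

nearestℤ : ∀ m d → d ≢ + 0 → Σ ℤ λ x → 0≤ d * d + - (+ 4 * ((m + - (d * x)) * (m + - (d * x))))
nearestℤ m (+ zero) d≢0 = ⊥-elim (d≢0 refl)
nearestℤ m (+ suc k) _ = division⇒nearest m (+ suc k) (+ (m %ℕ suc k)) (m /ℕ suc k) (a≡a%ℕn+[a/ℕn]*n m (suc k))
  (+≤+ z≤n) (+≤+ z≤n) (ℤ.i≤j⇒0≤j-i (+≤+ (ℕ.<⇒≤ (n%ℕd<d m (suc k)))))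
nearestℤ m -[1+ k ] _ = negate m (+ suc k) (nearestℤ m (+ suc k) (λ ()))
  where
  negate : ∀ m d → (Σ ℤ λ x → 0≤ d * d + - (+ 4 * ((m + - (d * x)) * (m + - (d * x)))))
    → Σ ℤ λ x → 0≤ (- d) * (- d) + - (+ 4 * ((m + - ((- d) * x)) * (m + - ((- d) * x))))
  negate m d (x , p) = - x , subst 0≤_ (solve 3 (λ m d x →
      d :* d :+ :- (con (+ 4) :* ((m :+ :- (d :* x)) :* (m :+ :- (d :* x))))
      := (:- d) :* (:- d) :+ :- (con (+ 4) :* ((m :+ :- ((:- d) :* (:- x))) :* (m :+ :- ((:- d) :* (:- x))))))
      refl m d x) p

-- Norms of differences, estimated by the trace form

Δ : OF → OF → OF
Δ x y = x +O -O y

-- q z - 2 N z = (z - z′)² = 5 b² and q z + 2 N z = (z + z′)² = (2 a + b)².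
∣2N∣≤q : ∀ z → ∣ + 2 * N z ∣≤ q z
∣2N∣≤q (mkO a b)
  = subst 0≤_ (solve 2 (λ a b → con (+ 5) :* (b :* b) := qᵖ a b :- con (+ 2) :* Nᵖ a b) refl a b)
      (0≤-scale 5 (0≤-square b))
  , subst 0≤_ (solve 2 (λ a b → (con (+ 2) :* a :+ b) :* (con (+ 2) :* a :+ b) := qᵖ a b :+ con (+ 2) :* Nᵖ a b) refl a b)
      (0≤-square (+ 2 * a + b))

-- The parallelogram law with the term `q (z +O w)` dropped.
q-Δ-bound : ∀ z w → 0≤ + 2 * q z + + 2 * q w + - q (Δ z w)
q-Δ-bound z@(mkO a b) w@(mkO c d) = subst 0≤_
  (solve 4 (λ a b c d → qᵖ (a :+ c) (b :+ d)
     := con (+ 2) :* qᵖ a b :+ con (+ 2) :* qᵖ c d :- qᵖ (a :- c) (b :- d)) refl a b c d)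
  (0≤q (z +O w))

-- The weights 8 : 5 approximate ε : 1, the best ratio when q z and q (ε w) have equal bounds.
q-Δ-weighted-bound : ∀ z w → 0≤ + 104 * q z + + 65 * q w + - (+ 40 * q (Δ z w))
q-Δ-weighted-bound z@(mkO a b) w@(mkO c d) = subst 0≤_
  (solve 4 (λ a b c d → qᵖ (con (+ 8) :* a :+ con (+ 5) :* c) (con (+ 8) :* b :+ con (+ 5) :* d)
     := con (+ 104) :* qᵖ a b :+ con (+ 65) :* qᵖ c d :- con (+ 40) :* qᵖ (a :- c) (b :- d)) refl a b c d)
  (0≤q (mkO (+ 8 * a + + 5 * c) (+ 8 * b + + 5 * d)))

-- ε² < 21/8.
q≤21/8q-ε* : ∀ w → 0≤ + 21 * q (εO *O w) + - (+ 8 * q w)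
q≤21/8q-ε* w@(mkO a b) = 0≤-unscale 46 _ (subst 0≤_
  (solve 2 (λ a b → (con (+ 47) :* a :+ con (+ 76) :* b) :* (con (+ 47) :* a :+ con (+ 76) :* b) :+ con (+ 5) :* (b :* b)
     := con (+ 47) :* (con (+ 21) :* qᵖ (reᵖ (con (+ 0)) (con (+ 1)) a b) (imᵖ (con (+ 0)) (con (+ 1)) a b)
          :- con (+ 8) :* qᵖ a b)) refl a b)
  (0≤-+ (0≤-square (+ 47 * a + + 76 * b)) (0≤-scale 5 (0≤-square b))))

∣N∣-scale : ∀ f → ∣ N f ∣ ≡ 1 → ∀ z → ∣ N (f *O z) ∣ ≡ ∣ N z ∣
∣N∣-scale f ∣Nf∣≡1 z = trans (∣N-*∣ f z) (trans (cong (ℕ._* ∣ N z ∣) ∣Nf∣≡1) (ℕ.*-identityˡ _))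

strict-bound⇒abs : ∀ {v m} → 0≤ m + - v + - + 1 → 0≤ m + v + - + 1 → ∣ v ∣ ℕ.< ∣ m ∣
strict-bound⇒abs {v} {m} p₁ p₂ = ℤ.drop‿+<+ (subst (_ <_) (sym +∣m∣≡m) (∣v∣<m v p₁ p₂))
  where
  0≤m : 0≤ m
  0≤m = 0≤-unscale 1 m (subst 0≤_
    (solve 2 (λ m v → m :- v :- con (+ 1) :+ (m :+ v :- con (+ 1)) :+ con (+ 2) := con (+ 2) :* m) refl m v)
    (0≤-+ (0≤-+ p₁ p₂) (+≤+ z≤n)))
  +∣m∣≡m : + ∣ m ∣ ≡ m
  +∣m∣≡m = ℤ.0≤i⇒+∣i∣≡i 0≤m
  ∣v∣<m : ∀ v → 0≤ m + - v + - + 1 → 0≤ m + v + - + 1 → + ∣ v ∣ < m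
  ∣v∣<m (+ a) p _ = ℤ.suc[i]≤j⇒i<j (ℤ.0≤i-j⇒j≤i (subst 0≤_
    (solve 2 (λ m v → m :- v :- con (+ 1) := m :- (con (+ 1) :+ v)) refl m (+ a)) p))
  ∣v∣<m -[1+ a ] _ p = ℤ.suc[i]≤j⇒i<j (ℤ.0≤i-j⇒j≤i (subst 0≤_
    (solve 2 (λ m v → m :+ :- v :- con (+ 1) := m :- (con (+ 1) :+ v)) refl m (+ suc a)) p))

-- Here `s`, `t`, `d`, `v` stand for q z, q w, q (z - w), N (z - w). In units of `m`, s ≤ 9/4 and t
-- ≤ 9/8 give d ≤ 27/4 and |v| ≤ 27/8. The surplus `4 * m` relaxes this to the constant 31/8 shared
-- with `consecutive-bound`.
near-bound : ∀ {m s t d v} → 0≤ m → 0≤ + 9 * m + - (+ 4 * s) → 0≤ + 9 * m + - (+ 8 * t)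
  → 0≤ + 2 * s + + 2 * t + - d → ∣ + 2 * v ∣≤ d → ∣ + 8 * v ∣≤ + 31 * m
near-bound {m} {s} {t} {d} {v} hm hs ht hd (hv₁ , hv₂)
  = subst 0≤_ (solve 5 (λ m s t d v → con (+ 4) :* m :+ con (+ 2) :* (con (+ 9) :* m :- con (+ 4) :* s)
        :+ (con (+ 9) :* m :- con (+ 8) :* t) :+ con (+ 4) :* (con (+ 2) :* s :+ con (+ 2) :* t :- d)
        :+ con (+ 4) :* (d :- con (+ 2) :* v) := con (+ 31) :* m :- con (+ 8) :* v) refl m s t d v)
      (0≤-+ common (0≤-scale 4 hv₁))
  , subst 0≤_ (solve 5 (λ m s t d v → con (+ 4) :* m :+ con (+ 2) :* (con (+ 9) :* m :- con (+ 4) :* s)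
        :+ (con (+ 9) :* m :- con (+ 8) :* t) :+ con (+ 4) :* (con (+ 2) :* s :+ con (+ 2) :* t :- d)
        :+ con (+ 4) :* (d :+ con (+ 2) :* v) := con (+ 31) :* m :+ con (+ 8) :* v) refl m s t d v)
      (0≤-+ common (0≤-scale 4 hv₂))
  where
  common : 0≤ + 4 * m + + 2 * (+ 9 * m + - (+ 4 * s)) + (+ 9 * m + - (+ 8 * t)) + + 4 * (+ 2 * s + + 2 * t + - d)
  common = 0≤-+ (0≤-+ (0≤-+ (0≤-scale 4 hm) (0≤-scale 2 hs)) ht) (0≤-scale 4 hd)

-- Now `t′` stands for q (ε w). In units of `m`, s ≤ 9/8 and t ≤ 21/8 · 9/8, and the weighted
-- inequality yields |v| < 3.87. Plain `q-Δ-bound` would yield only 4.08, which is useless, so the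
-- weights are essential. The large multipliers eliminate `s`, `t`, `t′` and `d`.
consecutive-bound : ∀ {m s t t′ d v} → 0≤ m → 0≤ + 9 * m + - (+ 8 * s) → 0≤ + 9 * m + - (+ 8 * t′)
  → 0≤ + 21 * t′ + - (+ 8 * t) → 0≤ + 104 * s + + 65 * t + - (+ 40 * d) → ∣ + 2 * v ∣≤ d → ∣ + 8 * v ∣≤ + 31 * m
consecutive-bound {m} {s} {t} {t′} {d} {v} hm hs ht′ ht hd (hv₁ , hv₂)
  = 0≤-unscale 639 (+ 31 * m + - (+ 8 * v)) (subst 0≤_ (solve 6 (λ m s t t′ d v →
        con (+ 67) :* m :+ con (+ 832) :* (con (+ 9) :* m :- con (+ 8) :* s)
        :+ con (+ 1365) :* (con (+ 9) :* m :- con (+ 8) :* t′) :+ con (+ 520) :* (con (+ 21) :* t′ :- con (+ 8) :* t)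
        :+ con (+ 64) :* (con (+ 104) :* s :+ con (+ 65) :* t :- con (+ 40) :* d) :+ con (+ 2560) :* (d :- con (+ 2) :* v)
        := con (+ 640) :* (con (+ 31) :* m :- con (+ 8) :* v)) refl m s t t′ d v)
      (0≤-+ common (0≤-scale 2560 hv₁)))
  , 0≤-unscale 639 (+ 31 * m + + 8 * v) (subst 0≤_ (solve 6 (λ m s t t′ d v →
        con (+ 67) :* m :+ con (+ 832) :* (con (+ 9) :* m :- con (+ 8) :* s)
        :+ con (+ 1365) :* (con (+ 9) :* m :- con (+ 8) :* t′) :+ con (+ 520) :* (con (+ 21) :* t′ :- con (+ 8) :* t)
        :+ con (+ 64) :* (con (+ 104) :* s :+ con (+ 65) :* t :- con (+ 40) :* d) :+ con (+ 2560) :* (d :+ con (+ 2) :* v)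
        := con (+ 640) :* (con (+ 31) :* m :+ con (+ 8) :* v)) refl m s t t′ d v)
      (0≤-+ common (0≤-scale 2560 hv₂)))
  where
  common : 0≤ + 67 * m + + 832 * (+ 9 * m + - (+ 8 * s)) + + 1365 * (+ 9 * m + - (+ 8 * t′))
    + + 520 * (+ 21 * t′ + - (+ 8 * t)) + + 64 * (+ 104 * s + + 65 * t + - (+ 40 * d))
  common = 0≤-+ (0≤-+ (0≤-+ (0≤-+ (0≤-scale 67 hm) (0≤-scale 832 hs)) (0≤-scale 1365 ht′))
    (0≤-scale 520 ht)) (0≤-scale 64 hd)

-- The points of O_F close to A / n

module Approximation (n : ℤ) (n≢0 : n ≢ + 0) where

  M : ℤ
  M = n * n

  1≤M : 0≤ M + - + 1
  1≤M = square≥1 n n≢0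

  0≤M : 0≤ M
  0≤M = 0≤-square n

  ¬0≤-kM : ∀ k → ¬ (0≤ + suc k * (- M))
  ¬0≤-kM k p = ¬0≤-1 (subst 0≤_ (solve 1 (λ m → :- m :+ (m :- con (+ 1)) := :- con (+ 1)) refl M)
    (0≤-+ (0≤-unscale k (- M) p) 1≤M))

  ι : OF
  ι = mkO n (+ 0)

  remainder : OF → OF → OF
  remainder A x = A +O -O (ι *O x)

  -- |N (A / n − x)| < 1.
  Close : OF → OF → Set
  Close A x = ∣ N (remainder A x) ∣ ℕ.< ∣ M ∣

  -- Only interior points of a path have to be close: an end may lie on the boundary, and whoever
  -- recurses over a path provides the data at its ends.
  data Connected (A : OF) : OF → OF → Set where
    here : ∀ {x} → Connected A x x
    link : ∀ {x y} → ∣ N (Δ x y) ∣ ≡ 1 → Connected A x y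
    via  : ∀ {x y z} → Connected A x y → Close A y → Connected A y z → Connected A x z
    back : ∀ {x y} → Connected A x y → Connected A y x

  -- Diagonalise 2 q = (2 a + b)² + 5 b². Choosing `y` first makes the second coordinate at most n /
  -- 2, then `x` makes 2 a + b at most n, in absolute value. Hence 2 q ≤ n² + 5 n² / 4.
  nearest : ∀ A → Σ OF λ x → 0≤ + 9 * M + - (+ 8 * q (remainder A x))
  nearest A@(mkO a b) with nearestℤ b n n≢0
  ... | y , hy with nearestℤ (+ 2 * a + (b + - (n * y))) (+ 2 * n) (λ 2n≡0 → n≢0 (ℤ.*-cancelˡ-≡ (+ 2) n (+ 0) 2n≡0))
  ... | x , hx = mkO x y , subst 0≤_
    (solve 5 (λ a b n x y →
      (con (+ 2) :* n :* (con (+ 2) :* n) :- con (+ 4) :*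
        ((con (+ 2) :* a :+ (b :- n :* y) :- con (+ 2) :* n :* x) :* (con (+ 2) :* a :+ (b :- n :* y) :- con (+ 2) :* n :* x)))
      :+ con (+ 5) :* (n :* n :- con (+ 4) :* ((b :- n :* y) :* (b :- n :* y)))
      := con (+ 9) :* (n :* n) :- con (+ 8) :* qᵖ (a :- (n :* x :+ con (+ 0) :* y)) (b :- (n :* y :+ con (+ 0) :* x :+ con (+ 0) :* y)))
      refl a b n x y)
    (0≤-+ hx (0≤-scale 5 hy))

  abstract
    round : OF → OF
    round A = proj₁ (nearest A)

    round-bound : ∀ A → 0≤ + 9 * M + - (+ 8 * q (remainder A (round A)))
    round-bound A = proj₂ (nearest A)

  9/16-bound : ∀ {v} → 0≤ + 9 * M + - (+ 16 * v) → 0≤ M + - v + - + 1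
  9/16-bound {v} p with 0≤-split (M + - v + - + 1)
  ... | inj₁ r = r
  ... | inj₂ r = ⊥-elim (¬0≤-kM 6 (subst 0≤_
    (solve 2 (λ m v → con (+ 16) :* (:- (m :- v :- con (+ 1)) :- con (+ 1)) :+ (con (+ 9) :* m :- con (+ 16) :* v)
      := con (+ 7) :* (:- m)) refl M v)
    (0≤-+ (0≤-scale 16 r) p)))

  -- From 2 |N| ≤ q ≤ 9/8 M the norm is at most 9/16 M: the norm-Euclidean property.
  round-close : ∀ A → Close A (round A)
  round-close A = strict-bound⇒abs {N z} {M}
      (9/16-bound (subst 0≤_ (solve 3 (λ m q v → con (+ 9) :* m :- con (+ 8) :* q :+ con (+ 8) :* (q :- con (+ 2) :* v)
        := con (+ 9) :* m :- con (+ 16) :* v) refl M (q z) (N z))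
        (0≤-+ (round-bound A) (0≤-scale 8 (proj₁ (∣2N∣≤q z))))))
      (subst (λ v → 0≤ M + v + - + 1) (ℤ.neg-involutive (N z)) (9/16-bound (subst 0≤_
        (solve 3 (λ m q v → con (+ 9) :* m :- con (+ 8) :* q :+ con (+ 8) :* (q :+ con (+ 2) :* v)
        := con (+ 9) :* m :- con (+ 16) :* (:- v)) refl M (q z) (N z))
        (0≤-+ (round-bound A) (0≤-scale 8 (proj₂ (∣2N∣≤q z)))))))
    where
    z : OF
    z = remainder A (round A)

  N-Δ-remainder : ∀ A x y → N (Δ (remainder A x) (remainder A y)) ≡ M * N (Δ x y)
  N-Δ-remainder (mkO a b) (mkO x₁ x₂) (mkO y₁ y₂) = solve 7 (λ n a b x₁ x₂ y₁ y₂ →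
    Nᵖ (a :- (n :* x₁ :+ con (+ 0) :* x₂) :- (a :- (n :* y₁ :+ con (+ 0) :* y₂)))
       (b :- (n :* x₂ :+ con (+ 0) :* x₁ :+ con (+ 0) :* x₂) :- (b :- (n :* y₂ :+ con (+ 0) :* y₁ :+ con (+ 0) :* y₂)))
    := n :* n :* Nᵖ (x₁ :- y₁) (x₂ :- y₂)) refl n a b x₁ x₂ y₁ y₂

  31/8-bound : ∀ {v} → 0≤ + 31 * M + - (+ 8 * (M * v)) → 0≤ + 3 + - v
  31/8-bound {v} p with 0≤-split (+ 3 + - v)
  ... | inj₁ r = r
  ... | inj₂ r = ⊥-elim (¬0≤-kM 0 (subst 0≤_
    (solve 2 (λ m v → con (+ 8) :* (m :* (:- (con (+ 3) :- v) :- con (+ 1))) :+ (con (+ 31) :* m :- con (+ 8) :* (m :* v))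
      := con (+ 1) :* (:- m)) refl M v)
    (0≤-+ (0≤-scale 8 (0≤-* 0≤M r)) p)))

  ∣N-Δ∣<4M⇒linked : ∀ A x y → ∣ + 8 * N (Δ (remainder A x) (remainder A y)) ∣≤ + 31 * M → x ≡ y ⊎ ∣ N (Δ x y) ∣ ≡ 1
  ∣N-Δ∣<4M⇒linked A x y (p₁ , p₂) = Sum.map Δ≡0⇒≡ (λ u → u) (∣N∣≤3⇒zero⊎unit (Δ x y) (bound⇒abs {N (Δ x y)} {3}
      ( 31/8-bound {N (Δ x y)} (subst (λ v → 0≤ + 31 * M + - (+ 8 * v)) (N-Δ-remainder A x y) p₁)
      , subst (λ v → 0≤ + 3 + v) (ℤ.neg-involutive (N (Δ x y))) (31/8-bound { - N (Δ x y)} (subst 0≤_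
          (trans (cong (λ v → + 31 * M + + 8 * v) (N-Δ-remainder A x y)) (flip-sign M (N (Δ x y)))) p₂)))))
    where
    flip-sign : ∀ m v → + 31 * m + + 8 * (m * v) ≡ + 31 * m + - (+ 8 * (m * - v))
    flip-sign = solve 2 (λ m v → con (+ 31) :* m :+ con (+ 8) :* (m :* v) := con (+ 31) :* m :- con (+ 8) :* (m :* :- v)) refl
    Δ+y : ∀ x y → x +O -O y +O y ≡ x
    Δ+y = solve-∀ O-ring
    0+y : ∀ y → zeroO +O y ≡ y
    0+y = solve-∀ O-ring
    Δ≡0⇒≡ : Δ x y ≡ zeroO → x ≡ y
    Δ≡0⇒≡ Δ≡0 = trans (sym (Δ+y x y)) (trans (cong (_+O y) Δ≡0) (0+y y))

  near⇒linked : ∀ A x y → 0≤ + 9 * M + - (+ 4 * q (remainder A x)) → 0≤ + 9 * M + - (+ 8 * q (remainder A y))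
    → x ≡ y ⊎ ∣ N (Δ x y) ∣ ≡ 1
  near⇒linked A x y hx hy = ∣N-Δ∣<4M⇒linked A x y
    (near-bound {M} {q z} {q w} {q (Δ z w)} {N (Δ z w)} 0≤M hx hy (q-Δ-bound z w) (∣2N∣≤q (Δ z w)))
    where
    z w : OF
    z = remainder A x
    w = remainder A y

  remainder-scale : ∀ f g → (∀ z → f *O (g *O z) ≡ z) → ∀ A x → f *O remainder A (g *O x) ≡ remainder (f *O A) x
  remainder-scale f g fg A x = trans (distrib f A ι (g *O x)) (cong (λ y → f *O A +O -O (ι *O y)) (fg x))
    where
    distrib : ∀ f A c x → f *O (A +O -O (c *O x)) ≡ f *O A +O -O (c *O (f *O x))
    distrib = solve-∀ O-ring

  consecutive-rounds : ∀ A → round A ≡ εinvO *O round (εO *O A) ⊎ ∣ N (Δ (round A) (εinvO *O round (εO *O A))) ∣ ≡ 1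
  consecutive-rounds A = ∣N-Δ∣<4M⇒linked A x y
    (consecutive-bound {M} {q z} {q w} {q (εO *O w)} {q (Δ z w)} {N (Δ z w)}
      0≤M (round-bound A) hw (q≤21/8q-ε* w) (q-Δ-weighted-bound z w) (∣2N∣≤q (Δ z w)))
    where
    x y z w : OF
    x = round A
    y = εinvO *O round (εO *O A)
    z = remainder A x
    w = remainder A y
    hw : 0≤ + 9 * M + - (+ 8 * q (εO *O w))
    hw = subst (λ r → 0≤ + 9 * M + - (+ 8 * q r)) (sym (remainder-scale εO εinvO ε-ε⁻¹ A (round (εO *O A)))) (round-bound (εO *O A))

  scale-close : ∀ f g → (∀ z → f *O (g *O z) ≡ z) → ∣ N f ∣ ≡ 1 → ∀ {A x} → Close (f *O A) x → Close A (g *O x)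
  scale-close f g fg ∣Nf∣≡1 {A} {x} = subst (ℕ._< ∣ M ∣)
    (trans (cong (λ z → ∣ N z ∣) (sym (remainder-scale f g fg A x))) (∣N∣-scale f ∣Nf∣≡1 (remainder A (g *O x))))

  scale-Δ : ∀ g → ∣ N g ∣ ≡ 1 → ∀ {x y} → ∣ N (Δ x y) ∣ ≡ 1 → ∣ N (Δ (g *O x) (g *O y)) ∣ ≡ 1
  scale-Δ g ∣Ng∣≡1 {x} {y} u = trans (cong (λ z → ∣ N z ∣) (factor g x y)) (trans (∣N∣-scale g ∣Ng∣≡1 (Δ x y)) u)
    where
    factor : ∀ g x y → g *O x +O -O (g *O y) ≡ g *O (x +O -O y)
    factor = solve-∀ O-ring

  scale-connected : ∀ f g → (∀ z → f *O (g *O z) ≡ z) → ∣ N f ∣ ≡ 1 → ∣ N g ∣ ≡ 1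
    → ∀ {A x y} → Connected (f *O A) x y → Connected A (g *O x) (g *O y)
  scale-connected f g fg Nf Ng = go
    where
    go : ∀ {A x y} → Connected (f *O A) x y → Connected A (g *O x) (g *O y)
    go here        = here
    go (link {x} {y} u) = link (scale-Δ g Ng {x} {y} u)
    go {A} (via {y = y} p c r) = via (go p) (scale-close f g fg Nf {A} {y} c) (go r)
    go (back p)    = back (go p)

  linked⇒connected : ∀ {A x y} → x ≡ y ⊎ ∣ N (Δ x y) ∣ ≡ 1 → Connected A x y
  linked⇒connected (inj₁ refl) = here
  linked⇒connected {x = x} {y} (inj₂ u) = link {x = x} {y} u

  rounds-connected : ∀ A → Connected A (round A) (εinvO *O round (εO *O A))
  rounds-connected A = linked⇒connected {A} {round A} {εinvO *O round (εO *O A)} (consecutive-rounds A)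

  rounds-connected′ : ∀ A → Connected A (εO *O round (εinvO *O A)) (round A)
  rounds-connected′ A = subst (Connected A (εO *O round (εinvO *O A)))
    (trans (ε-ε⁻¹ (round (εO *O (εinvO *O A)))) (cong round (ε-ε⁻¹ A)))
    (scale-connected εinvO εO ε⁻¹-ε refl refl {A} (rounds-connected (εinvO *O A)))

  -- r ≤ √5 M < 9/4 M, since 81/16 exceeds 5. In the certificate the excess of 81 over 80 is the
  -- term m² - 1.
  near-minimum : ∀ {v r} → ∣ v ∣≤ M → 0≤ r → 0≤ + 5 * (v * v) + - (r * r) → 0≤ + 9 * M + - (+ 4 * r)
  near-minimum {v} {r} (v₁ , v₂) 0≤r r²≤5v² = bound M 1≤M 0≤M v₁ v₂
    where
    bound : ∀ m → 0≤ m + - + 1 → 0≤ m → 0≤ m + - v → 0≤ m + v → 0≤ + 9 * m + - (+ 4 * r)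
    bound m 1≤m 0≤m v₁ v₂ with 0≤-split (+ 9 * m + - (+ 4 * r))
    ... | inj₁ p = p
    ... | inj₂ p = ⊥-elim (¬0≤-1 (subst 0≤_ (solve 3 (λ m v r →
          con (+ 16) :* (con (+ 5) :* (v :* v) :- r :* r)
          :+ (:- (con (+ 9) :* m :- con (+ 4) :* r) :- con (+ 1)) :* (con (+ 4) :* r :+ con (+ 9) :* m)
          :+ (con (+ 4) :* r :+ con (+ 9) :* m) :+ con (+ 80) :* ((m :- v) :* (m :+ v))
          :+ (m :- con (+ 1)) :* (m :+ con (+ 1)) := :- con (+ 1)) refl m v r)
        (0≤-+ (0≤-+ (0≤-+ (0≤-+ (0≤-scale 16 r²≤5v²) (0≤-* p 4r+9m)) 4r+9m) (0≤-scale 80 (0≤-* v₁ v₂)))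
          (0≤-* 1≤m (0≤-+ 0≤m (+≤+ z≤n))))))
      where
      4r+9m : 0≤ + 4 * r + + 9 * m
      4r+9m = 0≤-+ (0≤-scale 4 0≤r) (0≤-scale 9 0≤m)

  -- The initial unit step makes room for an `x` that is not close itself, so that the boundary case
  -- goes through the same induction.
  Reaches : OF → OF → Set
  Reaches A x = Σ OF λ y → Close A y × (x ≡ y ⊎ ∣ N (Δ x y) ∣ ≡ 1) × Connected A y (round A)

  scale-reaches : ∀ f g → (∀ z → f *O (g *O z) ≡ z) → (∀ z → g *O (f *O z) ≡ z) → ∣ N f ∣ ≡ 1 → ∣ N g ∣ ≡ 1
    → ∀ A x → Connected A (g *O round (f *O A)) (round A) → Reaches (f *O A) (f *O x) → Reaches A x
  scale-reaches f g fg gf Nf Ng A x rounds (y , close , linked , path) =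
    g *O y , scale-close f g fg Nf {A} {y} close , scale-linked linked ,
    via (scale-connected f g fg Nf Ng {A} path) (scale-close f g fg Nf {A} {round (f *O A)} (round-close (f *O A))) rounds
    where
    scale-linked : f *O x ≡ y ⊎ ∣ N (Δ (f *O x) y) ∣ ≡ 1 → x ≡ g *O y ⊎ ∣ N (Δ x (g *O y)) ∣ ≡ 1
    scale-linked (inj₁ fx≡y) = inj₁ (trans (sym (gf x)) (cong (g *O_) fx≡y))
    scale-linked (inj₂ u)    = inj₂ (subst (λ x → ∣ N (Δ x (g *O y)) ∣ ≡ 1) (gf x) (scale-Δ g Ng {f *O x} {y} u))

  -- Scale by powers of ε until the remainder minimises `q`; there the rounded point serves as `y`.
  -- Each step back rescales the path found so far and appends the link between the roundings at the
  -- two neighbouring scales.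
  reaches : ∀ A x → ∣ N (remainder A x) ∣ ℕ.≤ ∣ M ∣ → Reaches A x
  reaches A x = ε-induction P base
      (λ z ih A x → descend εO εinvO ε-ε⁻¹ ε⁻¹-ε refl refl (λ A → back (rounds-connected A)) z ih A x)
      (λ z ih A x → descend εinvO εO ε⁻¹-ε ε-ε⁻¹ refl refl rounds-connected′ z ih A x)
      (remainder A x) A x refl
    where
    P : OF → Set
    P z = ∀ A x → remainder A x ≡ z → ∣ N z ∣ ℕ.≤ ∣ M ∣ → Reaches A x
    base : ∀ z → 0≤ + 5 * (N z * N z) + - (q z * q z) → P z
    base z q²≤5N² A x refl ∣N∣≤∣M∣ = round A , round-close A ,
      near⇒linked A x (round A) (near-minimum {N z} {q z}
        (subst (∣ N z ∣≤_) (ℤ.0≤i⇒+∣i∣≡i 0≤M) (abs⇒bound {N z} {∣ M ∣} ∣N∣≤∣M∣)) (0≤q z) q²≤5N²) (round-bound A) , here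
    descend : ∀ f g → (∀ z → f *O (g *O z) ≡ z) → (∀ z → g *O (f *O z) ≡ z) → ∣ N f ∣ ≡ 1 → ∣ N g ∣ ≡ 1
      → (∀ A → Connected A (g *O round (f *O A)) (round A)) → ∀ z → P (f *O z) → P z
    descend f g fg gf Nf Ng rounds z ih A x refl le = scale-reaches f g fg gf Nf Ng A x (rounds A)
      (ih (f *O A) (f *O x) (trans (sym (remainder-scale f g fg A (f *O x))) (cong (λ y → f *O remainder A y) (gf x)))
        (subst (ℕ._≤ ∣ M ∣) (sym (∣N∣-scale f Nf z)) le))

  close⇒connected : ∀ A x y → Close A x → Close A y → Connected A x y
  close⇒connected A x y cx cy = join (reaches A x (ℕ.<⇒≤ cx)) (reaches A y (ℕ.<⇒≤ cy))
    where
    join : Reaches A x → Reaches A y → Connected A x y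
    join (_ , cx′ , lx , px) (_ , cy′ , ly , py) =
      via (linked⇒connected lx) cx′ (via px (round-close A) (via (back py) cy′ (back (linked⇒connected ly))))

  boundary⇒linked : ∀ A x → ∣ N (remainder A x) ∣ ≡ ∣ M ∣ → Σ OF λ y → Close A y × ∣ N (Δ x y) ∣ ≡ 1
  boundary⇒linked A x eq = choose (reaches A x (ℕ.≤-reflexive eq))
    where
    choose : Reaches A x → Σ OF λ y → Close A y × ∣ N (Δ x y) ∣ ≡ 1
    choose (y , cy , inj₂ u , _)    = y , cy , u
    choose (_ , cy , inj₁ refl , _) = ⊥-elim (ℕ.<-irrefl eq cy)

-- Integer powers of invertible maps

record Perm (S : Setoid 0ℓ 0ℓ) : Set where
  open Setoid S
  field
    fwd bwd  : Carrier → Carrier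
    fwd-cong : ∀ {x y} → x ≈ y → fwd x ≈ fwd y
    bwd-cong : ∀ {x y} → x ≈ y → bwd x ≈ bwd y
    fwd-bwd  : ∀ x → fwd (bwd x) ≈ x
    bwd-fwd  : ∀ x → bwd (fwd x) ≈ x

module _ {S : Setoid 0ℓ 0ℓ} where
  open Setoid S using (Carrier; _≈_) renaming (refl to ≈refl; sym to ≈sym; trans to ≈trans)
  open Perm

  inv : Perm S → Perm S
  inv F = record { fwd = bwd F ; bwd = fwd F ; fwd-cong = bwd-cong F ; bwd-cong = fwd-cong F
                 ; fwd-bwd = bwd-fwd F ; bwd-fwd = fwd-bwd F }

  pow : Perm S → ℤ → Carrier → Carrier
  pow F (+ zero)     x = x
  pow F (+ suc k)    x = fwd F (pow F (+ k) x)
  pow F -[1+ zero ]  x = bwd F x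
  pow F -[1+ suc k ] x = bwd F (pow F -[1+ k ] x)

  pow-cong : ∀ F k {x y} → x ≈ y → pow F k x ≈ pow F k y
  pow-cong F (+ zero)     p = p
  pow-cong F (+ suc k)    p = fwd-cong F (pow-cong F (+ k) p)
  pow-cong F -[1+ zero ]  p = bwd-cong F p
  pow-cong F -[1+ suc k ] p = bwd-cong F (pow-cong F -[1+ k ] p)

  pow-suc : ∀ F k x → pow F (ℤ.suc k) x ≈ fwd F (pow F k x)
  pow-suc F (+ k)        x = ≈refl
  pow-suc F -[1+ zero ]  x = ≈sym (fwd-bwd F x)
  pow-suc F -[1+ suc k ] x = ≈sym (fwd-bwd F (pow F -[1+ k ] x))

  pow-pred : ∀ F k x → pow F (ℤ.pred k) x ≈ bwd F (pow F k x)
  pow-pred F (+ zero)  x = ≈refl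
  pow-pred F (+ suc k) x = ≈sym (bwd-fwd F (pow F (+ k) x))
  pow-pred F -[1+ k ]  x = ≈refl

  pow-+ : ∀ F i j x → pow F (i + j) x ≈ pow F i (pow F j x)
  pow-+ F (+ zero) j x = subst (λ i → pow F i x ≈ pow F j x) (sym (ℤ.+-identityˡ j)) ≈refl
  pow-+ F (+ suc k) j x = subst (λ i → pow F i x ≈ pow F (+ suc k) (pow F j x)) (sym (ℤ.+-assoc (+ 1) (+ k) j))
    (≈trans (pow-suc F (+ k + j) x) (fwd-cong F (pow-+ F (+ k) j x)))
  pow-+ F -[1+ zero ] j x = pow-pred F j x
  pow-+ F -[1+ suc k ] j x = subst (λ i → pow F i x ≈ pow F -[1+ suc k ] (pow F j x)) (sym (ℤ.+-assoc -[1+ 0 ] -[1+ k ] j))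
    (≈trans (pow-pred F (-[1+ k ] + j) x) (bwd-cong F (pow-+ F -[1+ k ] j x)))

  pow-cancel : ∀ F k x → pow F k (pow F (- k) x) ≈ x
  pow-cancel F k x = ≈trans (≈sym (pow-+ F k (- k) x)) (subst (λ i → pow F i x ≈ x) (sym (ℤ.+-inverseʳ k)) ≈refl)

  pow-inv : ∀ F k x → pow (inv F) k x ≈ pow F (- k) x
  pow-inv F (+ zero)        x = ≈refl
  pow-inv F (+ suc zero)    x = ≈refl
  pow-inv F (+ suc (suc k)) x = bwd-cong F (pow-inv F (+ suc k) x)
  pow-inv F -[1+ zero ]     x = ≈refl
  pow-inv F -[1+ suc k ]    x = fwd-cong F (pow-inv F -[1+ k ] x)

  -- A commutation rule for the forward maps implies the one for their inverses, so each rule has to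
  -- be checked on a single positive generator.
  intertwine : (F G : Perm S) (h : Carrier → Carrier) → (∀ {x y} → x ≈ y → h x ≈ h y)
    → (∀ x → h (fwd F x) ≈ fwd G (h x)) → ∀ k x → h (pow F k x) ≈ pow G k (h x)
  intertwine F G h h-cong hf = go
    where
    hb : ∀ x → h (bwd F x) ≈ bwd G (h x)
    hb x = ≈trans (≈sym (bwd-fwd G _)) (bwd-cong G (≈trans (≈sym (hf (bwd F x))) (h-cong (fwd-bwd F x))))
    go : ∀ k x → h (pow F k x) ≈ pow G k (h x)
    go (+ zero)     x = ≈refl
    go (+ suc k)    x = ≈trans (hf _) (fwd-cong G (go (+ k) x))
    go -[1+ zero ]  x = hb x
    go -[1+ suc k ] x = ≈trans (hb _) (bwd-cong G (go -[1+ k ] x))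

-- Units

*ε : Perm (setoid OF)
*ε = record { fwd = εO *O_ ; bwd = εinvO *O_ ; fwd-cong = cong (εO *O_) ; bwd-cong = cong (εinvO *O_) ; fwd-bwd = ε-ε⁻¹ ; bwd-fwd = ε⁻¹-ε }

εpow-pow : ∀ k x → εpow k *O x ≡ pow *ε k x
εpow-pow (+ zero)     x = *O-identityˡ x
εpow-pow (+ suc k)    x = trans (*O-assoc εO (εpow (+ k)) x) (cong (εO *O_) (εpow-pow (+ k) x))
εpow-pow -[1+ zero ]  x = refl
εpow-pow -[1+ suc k ] x = trans (*O-assoc εinvO (εpow -[1+ k ]) x) (cong (εinvO *O_) (εpow-pow -[1+ k ] x))

*O-identityʳ : ∀ x → x *O oneO ≡ x
*O-identityʳ = solve-∀ O-ring

εpow-+ : ∀ i j → εpow (i + j) ≡ εpow i *O εpow j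
εpow-+ i j = begin
  εpow (i + j)               ≡⟨ *O-identityʳ (εpow (i + j)) ⟨
  εpow (i + j) *O oneO       ≡⟨ εpow-pow (i + j) oneO ⟩
  pow *ε (i + j) oneO        ≡⟨ pow-+ *ε i j oneO ⟩
  pow *ε i (pow *ε j oneO)   ≡⟨ εpow-pow i (pow *ε j oneO) ⟨
  εpow i *O pow *ε j oneO    ≡⟨ cong (εpow i *O_) (trans (sym (εpow-pow j oneO)) (*O-identityʳ (εpow j))) ⟩
  εpow i *O εpow j           ∎
  where open ≡-Reasoning

εpow-inverse : ∀ k → εpow k *O εpow (- k) ≡ oneO
εpow-inverse k = trans (sym (εpow-+ k (- k))) (cong εpow (ℤ.+-inverseʳ k))

IsUnit⇒∣N∣≡1 : ∀ u → IsUnit u → ∣ N u ∣ ≡ 1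
IsUnit⇒∣N∣≡1 u (v , uv≡1) = ℕ.m*n≡1⇒m≡1 ∣ N u ∣ ∣ N v ∣ (trans (sym (∣N-*∣ u v)) (cong (λ x → ∣ N x ∣) uv≡1))

∣N-εpow∣ : ∀ k → ∣ N (εpow k) ∣ ≡ 1
∣N-εpow∣ k = IsUnit⇒∣N∣≡1 (εpow k) (εpow (- k) , εpow-inverse k)

IsSign : OF → Set
IsSign e = e ≡ oneO ⊎ e ≡ -O oneO

-- At a minimum of `q` along multiplication by powers of ε a unit is rational by `small⇒rational`,
-- hence a sign.
unit-form : ∀ u → ∣ N u ∣ ≡ 1 → Σ OF λ e → Σ ℤ λ k → IsSign e × u ≡ εpow k *O e
unit-form = ε-induction _ base
  (λ u ih ∣N∣≡1 → shift εO ℤ.pred {u} (λ k e eq → trans (sym (ε⁻¹-ε u)) (trans (cong (εinvO *O_) eq) (pred-eq k e))) (ih (trans (∣N-ε*∣ u) ∣N∣≡1)))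
  (λ u ih ∣N∣≡1 → shift εinvO ℤ.suc {u} (λ k e eq → trans (sym (ε-ε⁻¹ u)) (trans (cong (εO *O_) eq) (suc-eq k e))) (ih (trans (∣N-ε⁻¹*∣ u) ∣N∣≡1)))
  where
  Form : OF → Set
  Form u = Σ OF λ e → Σ ℤ λ k → IsSign e × u ≡ εpow k *O e
  shift : ∀ f (g : ℤ → ℤ) {u} → (∀ k e → f *O u ≡ εpow k *O e → u ≡ εpow (g k) *O e) → Form (f *O u) → Form u
  shift f g back (e , k , s , eq) = e , g k , s , back k e eq
  pred-eq : ∀ k e → εinvO *O (εpow k *O e) ≡ εpow (ℤ.pred k) *O e
  pred-eq k e = sym (trans (εpow-pow (ℤ.pred k) e) (trans (pow-pred *ε k e) (cong (εinvO *O_) (sym (εpow-pow k e)))))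
  suc-eq : ∀ k e → εO *O (εpow k *O e) ≡ εpow (ℤ.suc k) *O e
  suc-eq k e = sym (trans (εpow-pow (ℤ.suc k) e) (trans (pow-suc *ε k e) (cong (εO *O_) (sym (εpow-pow k e)))))
  abs-one : ∀ a → ∣ a ∣ ≡ 1 → IsSign (mkO a (+ 0))
  abs-one (+ 1)     refl = inj₁ refl
  abs-one -[1+ 0 ]  refl = inj₂ refl
  base : ∀ u → 0≤ + 5 * (N u * N u) + - (q u * q u) → ∣ N u ∣ ≡ 1 → Form u
  base u@(mkO a b) q²≤5N² ∣N∣≡1 = u , + 0 , sign , sym (*O-identityˡ u)
    where
    1-N² : 0≤ + 1 + - (N u * N u)
    1-N² = subst (λ v → 0≤ + 1 + - v) (trans (cong (λ v → + v * + v) (sym ∣N∣≡1)) (sym (square-abs (N u)))) (+≤+ z≤n)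
      where
      square-abs : ∀ v → v * v ≡ + ∣ v ∣ * + ∣ v ∣
      square-abs (+ _)    = refl
      square-abs -[1+ _ ] = refl
    b≡0 : b ≡ + 0
    b≡0 = small⇒rational u q²≤5N² 1-N²
    sign : IsSign u
    sign = subst (λ b → IsSign (mkO a b)) (sym b≡0) (abs-one a (ℕ.m*n≡1⇒m≡1 ∣ a ∣ ∣ a ∣
      (trans (sym (ℤ.abs-* a a)) (trans (cong ∣_∣ (sym (N-rational a b≡0))) ∣N∣≡1))))

-- εᵏ⁺¹ = F_k + F_{k+1} ε with Fibonacci numbers F_k ≥ 0 and F_{k+1} > 0.
εpow-injective : ∀ i j → εpow i ≡ εpow j → i ≡ j
εpow-injective i j eq = ℤ.i-j≡0⇒i≡j i j (trivial (i + - j)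
  (trans (εpow-+ i (- j)) (trans (cong (_*O εpow (- j)) eq) (εpow-inverse j))))
  where
  fibonacci : ∀ k → Σ ℕ λ a → Σ ℕ λ b → εO ^O suc k ≡ mkO (+ a) (+ suc b)
  fibonacci zero = 0 , 0 , refl
  fibonacci (suc k) with fibonacci k
  ... | a , b , eq = suc b , a ℕ.+ b , trans (cong (εO *O_) eq) (cong₂ mkO
    (solve 2 (λ a b → con (+ 0) :* a :+ con (+ 1) :* b := b) refl (+ a) (+ suc b))
    (trans (solve 2 (λ a b → con (+ 0) :* b :+ con (+ 1) :* a :+ con (+ 1) :* b := a :+ b) refl (+ a) (+ suc b))
           (cong +_ (ℕ.+-suc a b))))
  positive : ∀ k → εO ^O suc k ≢ oneO
  positive k eq with fibonacci k
  ... | a , b , eq′ with trans (sym eq) eq′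
  ... | ()
  trivial : ∀ k → εpow k ≡ oneO → k ≡ + 0
  trivial (+ zero) _ = refl
  trivial (+ suc k) eq = ⊥-elim (positive k eq)
  trivial -[1+ k ] eq = ⊥-elim (positive k (trans (sym (*O-identityʳ (εO ^O suc k))) (trans (cong (εO ^O suc k *O_) (sym eq)) (εpow-inverse (+ suc k)))))

-- Identities in the presented group

~-setoid : Setoid 0ℓ 0ℓ
~-setoid = record { Carrier = Word ; _≈_ = _~_ ; isEquivalence = record { refl = ~refl ; sym = ~sym ; trans = ~trans } }

∷-cong : ∀ l {u v} → u ~ v → l ∷ u ~ l ∷ v
∷-cong l (step x y r) = step (l ∷ x) y r
∷-cong l ~refl = ~refl
∷-cong l (~sym p) = ~sym (∷-cong l p)
∷-cong l (~trans p r) = ~trans (∷-cong l p) (∷-cong l r)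

-- Group elements act on words by left multiplication. Identities of the presented group are stated
-- as equalities of such maps at an arbitrary tail `w`, which avoids regrouping concatenations.
letter : Gen → Perm ~-setoid
letter g = record
  { fwd = g⁺ g ∷_ ; bwd = g⁻ g ∷_ ; fwd-cong = ∷-cong (g⁺ g) ; bwd-cong = ∷-cong (g⁻ g)
  ; fwd-bwd = λ w → step [] w (cancel⁺ g) ; bwd-fwd = λ w → step [] w (cancel⁻ g) }

τ^ ν^ : ℤ → Word → Word
τ^ = pow (letter τ)
ν^ = pow (letter ν)

ν-conj : Perm ~-setoid → Perm ~-setoid
ν-conj F = record
  { fwd = λ w → n ∷ fwd (n⁻¹ ∷ w) ; bwd = λ w → n ∷ bwd (n⁻¹ ∷ w)
  ; fwd-cong = λ p → ∷-cong n (fwd-cong (∷-cong n⁻¹ p)) ; bwd-cong = λ p → ∷-cong n (bwd-cong (∷-cong n⁻¹ p))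
  ; fwd-bwd = λ w → ~trans (∷-cong n (~trans (fwd-cong (step [] _ (cancel⁻ ν))) (fwd-bwd _))) (step [] w (cancel⁺ ν))
  ; bwd-fwd = λ w → ~trans (∷-cong n (~trans (bwd-cong (step [] _ (cancel⁻ ν))) (bwd-fwd _))) (step [] w (cancel⁺ ν)) }
  where open Perm F

-- T (a + b ε) acts as left multiplication by τᵃ (ν τ ν⁻¹)ᵇ, the translation by a + b ε.
T : OF → Word → Word
T (mkO a b) w = τ^ a (n ∷ τ^ b (n⁻¹ ∷ w))

T-cong : ∀ x {u v} → u ~ v → T x u ~ T x v
T-cong (mkO a b) p = pow-cong (letter τ) a (∷-cong n (pow-cong (letter τ) b (∷-cong n⁻¹ p)))

θ : Perm ~-setoid
θ = ν-conj (letter τ)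

θ^ : ∀ b w → n ∷ τ^ b (n⁻¹ ∷ w) ~ pow θ b w
θ^ b w = ~sym (~trans (~sym (step [] _ (cancel⁺ ν))) (∷-cong n
  (intertwine θ (letter τ) (n⁻¹ ∷_) (∷-cong n⁻¹) (λ w → step [] _ (cancel⁻ ν)) b w)))

-- (iv') says that τ commutes with its conjugate by ν; two uses of `intertwine` pass to arbitrary
-- powers.
τ^-θ^ : ∀ a b w → n ∷ τ^ b (n⁻¹ ∷ τ^ a w) ~ τ^ a (n ∷ τ^ b (n⁻¹ ∷ w))
τ^-θ^ a b w = ~trans (θ^ b (τ^ a w)) (~trans (~sym
  (intertwine θ θ (τ^ a) (pow-cong (letter τ) a)
    (λ v → ~sym (intertwine (letter τ) (letter τ) (Perm.fwd θ) (Perm.fwd-cong θ) (λ v → ~sym (step [] v rel4)) a v)) b w))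
  (pow-cong (letter τ) a (~sym (θ^ b w))))

T-+ : ∀ x y w → T x (T y w) ~ T (x +O y) w
T-+ (mkO a b) (mkO c d) w = begin
  τ^ a (n ∷ τ^ b (n⁻¹ ∷ τ^ c (n ∷ τ^ d (n⁻¹ ∷ w))))  ≈⟨ pow-cong (letter τ) a (τ^-θ^ c b _) ⟩
  τ^ a (τ^ c (n ∷ τ^ b (n⁻¹ ∷ n ∷ τ^ d (n⁻¹ ∷ w))))  ≈⟨ pow-+ (letter τ) a c _ ⟨
  τ^ (a + c) (n ∷ τ^ b (n⁻¹ ∷ n ∷ τ^ d (n⁻¹ ∷ w)))
    ≈⟨ pow-cong (letter τ) (a + c) (∷-cong n (pow-cong (letter τ) b (step [] _ (cancel⁻ ν)))) ⟩
  τ^ (a + c) (n ∷ τ^ b (τ^ d (n⁻¹ ∷ w)))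
    ≈⟨ pow-cong (letter τ) (a + c) (∷-cong n (pow-+ (letter τ) b d _)) ⟨
  τ^ (a + c) (n ∷ τ^ (b + d) (n⁻¹ ∷ w))              ∎
  where open SetoidReasoning ~-setoid

T-zero : ∀ w → T zeroO w ~ w
T-zero w = step [] w (cancel⁺ ν)

T-+≡ : ∀ x y {z} → x +O y ≡ z → ∀ w → T x (T y w) ~ T z w
T-+≡ x y refl w = T-+ x y w

T-cancel : ∀ x w → T x (T (-O x) w) ~ w
T-cancel x w = ~trans (T-+≡ x (-O x) (inverse x) w) (T-zero w)
  where
  inverse : ∀ x → x +O -O x ≡ zeroO
  inverse = solve-∀ O-ring

T-cancel′ : ∀ x w → T (-O x) (T x w) ~ w
T-cancel′ x w = ~trans (T-+≡ (-O x) x (inverse x) w) (T-zero w)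
  where
  inverse : ∀ x → -O x +O x ≡ zeroO
  inverse = solve-∀ O-ring

translation : OF → Perm ~-setoid
translation x = record { fwd = T x ; bwd = T (-O x) ; fwd-cong = T-cong x ; bwd-cong = T-cong (-O x)
                       ; fwd-bwd = T-cancel x ; bwd-fwd = T-cancel′ x }

translation^ : ∀ x k w → pow (translation x) k w ~ T (mkO k (+ 0) *O x) w
translation^ x (+ zero) w = subst (λ y → w ~ T y w) (sym (zero* x)) (~sym (T-zero w))
  where
  zero* : ∀ x → zeroO *O x ≡ zeroO
  zero* = solve-∀ O-ring
translation^ x (+ suc k) w = ~trans (T-cong x (translation^ x (+ k) w)) (T-+≡ x (mkO (+ k) (+ 0) *O x) (suc* (mkO (+ k) (+ 0)) x) w)
  where
  suc* : ∀ c x → x +O c *O x ≡ (oneO +O c) *O x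
  suc* = solve-∀ O-ring
translation^ x -[1+ zero ] w = subst (λ y → T (-O x) w ~ T y w) (neg* x) ~refl
  where
  neg* : ∀ x → -O x ≡ -O oneO *O x
  neg* = solve-∀ O-ring
translation^ x -[1+ suc k ] w = ~trans (T-cong (-O x) (translation^ x -[1+ k ] w))
    (T-+≡ (-O x) (mkO -[1+ k ] (+ 0) *O x) (pred* (mkO -[1+ k ] (+ 0)) x) w)
  where
  pred* : ∀ c x → -O x +O c *O x ≡ (-O oneO +O c) *O x
  pred* = solve-∀ O-ring

-- Conjugation by ν takes τ to `θ` by definition and `θ` to τ `θ` by (v'). On translations this is 1
-- ↦ ε and ε ↦ 1 + ε = ε².
ν-T : ∀ x w → n ∷ T x w ~ T (εO *O x) (n ∷ w)
ν-T (mkO a b) w = begin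
  n ∷ τ^ a (n ∷ τ^ b (n⁻¹ ∷ w))
    ≈⟨ intertwine (letter τ) θ (n ∷_) (∷-cong n) (λ v → ∷-cong n (∷-cong t (~sym (step [] v (cancel⁻ ν))))) a _ ⟩
  pow θ a (n ∷ n ∷ τ^ b (n⁻¹ ∷ w))
    ≈⟨ pow-cong θ a (∷-cong n (θ^ b w)) ⟩
  pow θ a (n ∷ pow θ b w)
    ≈⟨ pow-cong θ a (intertwine θ (translation (mkO (+ 1) (+ 1))) (n ∷_) (∷-cong n) ν-θ b w) ⟩
  pow θ a (pow (translation (mkO (+ 1) (+ 1))) b (n ∷ w))
    ≈⟨ pow-cong θ a (translation^ (mkO (+ 1) (+ 1)) b (n ∷ w)) ⟩
  pow θ a (T (mkO b (+ 0) *O mkO (+ 1) (+ 1)) (n ∷ w))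
    ≈⟨ θ^ a _ ⟨
  T (mkO (+ 0) a) (T (mkO b (+ 0) *O mkO (+ 1) (+ 1)) (n ∷ w))
    ≈⟨ T-+≡ (mkO (+ 0) a) (mkO b (+ 0) *O mkO (+ 1) (+ 1)) (multiple a b) (n ∷ w) ⟩
  T (εO *O mkO a b) (n ∷ w) ∎
  where
  open SetoidReasoning ~-setoid
  ν-θ : ∀ v → n ∷ n ∷ t ∷ n⁻¹ ∷ v ~ T (mkO (+ 1) (+ 1)) (n ∷ v)
  ν-θ v = ~trans (~sym (step (n ∷ n ∷ t ∷ n⁻¹ ∷ []) v (cancel⁻ ν))) (step [] (n ∷ v) rel5)
  multiple : ∀ a b → mkO (+ 0) a +O mkO b (+ 0) *O mkO (+ 1) (+ 1) ≡ εO *O mkO a b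
  multiple a b = cong₂ mkO
    (solve 2 (λ a b → con (+ 0) :+ (b :* con (+ 1) :+ con (+ 0) :* con (+ 1)) := con (+ 0) :* a :+ con (+ 1) :* b) refl a b)
    (solve 2 (λ a b → a :+ (b :* con (+ 1) :+ con (+ 0) :* con (+ 1) :+ con (+ 0) :* con (+ 1))
       := con (+ 0) :* b :+ con (+ 1) :* a :+ con (+ 1) :* b) refl a b)

ν⁻¹-T : ∀ x w → n⁻¹ ∷ T x w ~ T (εinvO *O x) (n⁻¹ ∷ w)
ν⁻¹-T x w = begin
  n⁻¹ ∷ T x w                                       ≈⟨ ∷-cong n⁻¹ (T-cong x (step [] w (cancel⁺ ν))) ⟨
  n⁻¹ ∷ T x (n ∷ n⁻¹ ∷ w)                           ≡⟨ cong (λ y → n⁻¹ ∷ T y (n ∷ n⁻¹ ∷ w)) (ε-ε⁻¹ x) ⟨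
  n⁻¹ ∷ T (εO *O (εinvO *O x)) (n ∷ n⁻¹ ∷ w)        ≈⟨ ∷-cong n⁻¹ (ν-T (εinvO *O x) (n⁻¹ ∷ w)) ⟨
  n⁻¹ ∷ n ∷ T (εinvO *O x) (n⁻¹ ∷ w)                ≈⟨ step [] _ (cancel⁻ ν) ⟩
  T (εinvO *O x) (n⁻¹ ∷ w)                          ∎
  where open SetoidReasoning ~-setoid

ν^-T : ∀ k x w → ν^ k (T x w) ~ T (εpow k *O x) (ν^ k w)
ν^-T k x w = subst (λ y → ν^ k (T x w) ~ T y (ν^ k w)) (sym (εpow-pow k x)) (go k)
  where
  go : ∀ k → ν^ k (T x w) ~ T (pow *ε k x) (ν^ k w)
  go (+ zero)     = ~refl
  go (+ suc k)    = ~trans (∷-cong n (go (+ k))) (ν-T (pow *ε (+ k) x) (ν^ (+ k) w))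
  go -[1+ zero ]  = ν⁻¹-T x w
  go -[1+ suc k ] = ~trans (∷-cong n⁻¹ (go -[1+ k ])) (ν⁻¹-T (pow *ε -[1+ k ] x) (ν^ -[1+ k ] w))

σ² : ∀ w → s ∷ s ∷ w ~ w
σ² w = step [] w rel1

-- By (i') and (iii'), conjugation by σ inverts ν.
σ-ν^ : ∀ k w → s ∷ ν^ k w ~ ν^ (- k) (s ∷ w)
σ-ν^ k w = ~trans (intertwine (letter ν) (inv (letter ν)) (s ∷_) (∷-cong s) σ-ν k w) (pow-inv (letter ν) k (s ∷ w))
  where
  σ-ν : ∀ w → s ∷ n ∷ w ~ n⁻¹ ∷ s ∷ w
  σ-ν w = begin
    s ∷ n ∷ w                        ≈⟨ ∷-cong s (∷-cong n (σ² w)) ⟨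
    s ∷ n ∷ s ∷ s ∷ w                ≈⟨ step (s ∷ n ∷ s ∷ []) (s ∷ w) (cancel⁺ ν) ⟨
    s ∷ n ∷ s ∷ n ∷ n⁻¹ ∷ s ∷ w      ≈⟨ step [] (n⁻¹ ∷ s ∷ w) rel3 ⟩
    n⁻¹ ∷ s ∷ w                      ∎
    where open SetoidReasoning ~-setoid

T-one : ∀ w → T oneO w ~ t ∷ w
T-one w = ∷-cong t (T-zero w)

T-minus-one : ∀ w → T (-O oneO) w ~ t⁻¹ ∷ w
T-minus-one w = ∷-cong t⁻¹ (T-zero w)

-- (ii') in the form σ τ σ = τ⁻¹ σ τ⁻¹, together with the inverse of this equation.
σTσ-sign : ∀ e → IsSign e → ∀ w → s ∷ T e (s ∷ w) ~ T (-O e) (s ∷ T (-O e) w)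
σTσ-sign e (inj₁ refl) w = begin
  s ∷ T oneO (s ∷ w)                                   ≈⟨ ∷-cong s (T-one _) ⟩
  s ∷ t ∷ s ∷ w                                        ≈⟨ step (s ∷ t ∷ s ∷ []) w (cancel⁺ τ) ⟨
  s ∷ t ∷ s ∷ t ∷ t⁻¹ ∷ w                              ≈⟨ step (s ∷ t ∷ s ∷ t ∷ []) (t⁻¹ ∷ w) rel1 ⟨
  s ∷ t ∷ s ∷ t ∷ s ∷ s ∷ t⁻¹ ∷ w                      ≈⟨ step (s ∷ t ∷ s ∷ t ∷ s ∷ []) (s ∷ t⁻¹ ∷ w) (cancel⁺ τ) ⟨
  s ∷ t ∷ s ∷ t ∷ s ∷ t ∷ t⁻¹ ∷ s ∷ t⁻¹ ∷ w            ≈⟨ step [] (t⁻¹ ∷ s ∷ t⁻¹ ∷ w) rel2 ⟩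
  t⁻¹ ∷ s ∷ t⁻¹ ∷ w                                    ≈⟨ ~trans (T-minus-one _) (∷-cong t⁻¹ (∷-cong s (T-minus-one w))) ⟨
  T (-O oneO) (s ∷ T (-O oneO) w)                      ∎
  where open SetoidReasoning ~-setoid
σTσ-sign e (inj₂ refl) w = begin
  s ∷ T (-O oneO) (s ∷ w)                              ≈⟨ ∷-cong s (T-minus-one _) ⟩
  s ∷ t⁻¹ ∷ s ∷ w                                      ≈⟨ step (s ∷ t⁻¹ ∷ s ∷ []) w rel2 ⟨
  s ∷ t⁻¹ ∷ s ∷ s ∷ t ∷ s ∷ t ∷ s ∷ t ∷ w              ≈⟨ step (s ∷ t⁻¹ ∷ []) (t ∷ s ∷ t ∷ s ∷ t ∷ w) rel1 ⟩
  s ∷ t⁻¹ ∷ t ∷ s ∷ t ∷ s ∷ t ∷ w                      ≈⟨ step (s ∷ []) (s ∷ t ∷ s ∷ t ∷ w) (cancel⁻ τ) ⟩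
  s ∷ s ∷ t ∷ s ∷ t ∷ w                                ≈⟨ σ² _ ⟩
  t ∷ s ∷ t ∷ w                                        ≈⟨ ~trans (T-one _) (∷-cong t (∷-cong s (T-one w))) ⟨
  T oneO (s ∷ T oneO w)                                ∎
  where open SetoidReasoning ~-setoid

T-ν^ : ∀ k x w → T x (ν^ k w) ~ ν^ k (T (εpow (- k) *O x) w)
T-ν^ k x w = ~sym (~trans (ν^-T k (εpow (- k) *O x) w) (subst (λ y → T y (ν^ k w) ~ T x (ν^ k w)) (sym cancel) ~refl))
  where
  cancel : εpow k *O (εpow (- k) *O x) ≡ x
  cancel = trans (sym (*O-assoc (εpow k) (εpow (- k)) x)) (trans (cong (_*O x) (εpow-inverse k)) (*O-identityˡ x))

-- The triangle relation. Conjugating the case of a sign by a power of ν gives x = y = -u⁻¹. The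
-- witnesses may stay existential because only the shape is used later: `T` and powers of ν preserve
-- the height, and a single σ remains.
σTσ-unit : ∀ u → ∣ N u ∣ ≡ 1 → Σ OF λ x → Σ ℤ λ k → Σ OF λ y → ∀ w → s ∷ T u (s ∷ w) ~ T x (ν^ k (s ∷ T y w))
σTσ-unit u ∣N∣≡1 = conjugate (unit-form u ∣N∣≡1)
  where
  open SetoidReasoning ~-setoid
  νᵏ-cong : ∀ k {v w} → v ~ w → ν^ k v ~ ν^ k w
  νᵏ-cong = pow-cong (letter ν)
  conjugate : (Σ OF λ e → Σ ℤ λ k → IsSign e × u ≡ εpow k *O e)
    → Σ OF λ x → Σ ℤ λ k → Σ OF λ y → ∀ w → s ∷ T u (s ∷ w) ~ T x (ν^ k (s ∷ T y w))
  conjugate (e , k , sign , u≡) = x , - k + - k , x , λ w → begin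
    s ∷ T u (s ∷ w)                                    ≡⟨ cong (λ u → s ∷ T u (s ∷ w)) u≡ ⟩
    s ∷ T (εpow k *O e) (s ∷ w)                        ≈⟨ ∷-cong s (T-cong (εpow k *O e) (pow-cancel (letter ν) k (s ∷ w))) ⟨
    s ∷ T (εpow k *O e) (ν^ k (ν^ (- k) (s ∷ w)))      ≈⟨ ∷-cong s (ν^-T k e (ν^ (- k) (s ∷ w))) ⟨
    s ∷ ν^ k (T e (ν^ (- k) (s ∷ w)))                  ≈⟨ σ-ν^ k (T e (ν^ (- k) (s ∷ w))) ⟩
    ν^ (- k) (s ∷ T e (ν^ (- k) (s ∷ w)))              ≈⟨ νᵏ-cong (- k) (∷-cong s (T-cong e (σ-ν^ k w))) ⟨
    ν^ (- k) (s ∷ T e (s ∷ ν^ k w))                    ≈⟨ νᵏ-cong (- k) (σTσ-sign e sign (ν^ k w)) ⟩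
    ν^ (- k) (T (-O e) (s ∷ T (-O e) (ν^ k w)))        ≈⟨ ν^-T (- k) (-O e) (s ∷ T (-O e) (ν^ k w)) ⟩
    T x (ν^ (- k) (s ∷ T (-O e) (ν^ k w)))             ≈⟨ T-cong x (νᵏ-cong (- k) (∷-cong s (T-ν^ k (-O e) w))) ⟩
    T x (ν^ (- k) (s ∷ ν^ k (T x w)))                  ≈⟨ T-cong x (νᵏ-cong (- k) (σ-ν^ k (T x w))) ⟩
    T x (ν^ (- k) (ν^ (- k) (s ∷ T x w)))              ≈⟨ T-cong x (pow-+ (letter ν) (- k) (- k) (s ∷ T x w)) ⟨
    T x (ν^ (- k + - k) (s ∷ T x w))                   ∎
    where
    x : OF
    x = εpow (- k) *O -O e

-- Matrices up to scalars

mat-cong : ∀ {a b c d a′ b′ c′ d′} → a ≡ a′ → b ≡ b′ → c ≡ c′ → d ≡ d′ → mat a b c d ≡ mat a′ b′ c′ d′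
mat-cong refl refl refl refl = refl

row-assoc : ∀ a b e f g h x y → (a *O e +O b *O g) *O x +O (a *O f +O b *O h) *O y ≡ a *O (e *O x +O f *O y) +O b *O (g *O x +O h *O y)
row-assoc = solve-∀ O-ring

·-assoc : ∀ A B C → (A · B) · C ≡ A · (B · C)
·-assoc (mat a b c d) (mat e f g h) (mat x y z w) = mat-cong
  (row-assoc a b e f g h x z) (row-assoc a b e f g h y w) (row-assoc c d e f g h x z) (row-assoc c d e f g h y w)

I₂· : ∀ A → I₂ · A ≡ A
I₂· (mat a b c d) = mat-cong (first a c) (first b d) (second a c) (second b d)
  where
  first : ∀ x y → oneO *O x +O zeroO *O y ≡ x
  first = solve-∀ O-ring
  second : ∀ x y → zeroO *O x +O oneO *O y ≡ y
  second = solve-∀ O-ring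

·-scale : ∀ u A B → A · scale u B ≡ scale u (A · B)
·-scale u (mat a b c d) (mat e f g h) = mat-cong (entry u a b e g) (entry u a b f h) (entry u c d e g) (entry u c d f h)
  where
  entry : ∀ u a b x y → a *O (u *O x) +O b *O (u *O y) ≡ u *O (a *O x +O b *O y)
  entry = solve-∀ O-ring

scale-· : ∀ u A B → scale u A · B ≡ scale u (A · B)
scale-· u (mat a b c d) (mat e f g h) = mat-cong (entry u a b e g) (entry u a b f h) (entry u c d e g) (entry u c d f h)
  where
  entry : ∀ u a b x y → u *O a *O x +O u *O b *O y ≡ u *O (a *O x +O b *O y)
  entry = solve-∀ O-ring

scale-scale : ∀ u v A → scale u (scale v A) ≡ scale (u *O v) A
scale-scale u v (mat a b c d) = sym (mat-cong (*O-assoc u v a) (*O-assoc u v b) (*O-assoc u v c) (*O-assoc u v d))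

scale-one : ∀ A → scale oneO A ≡ A
scale-one (mat a b c d) = mat-cong (*O-identityˡ a) (*O-identityˡ b) (*O-identityˡ c) (*O-identityˡ d)

≡⇒≈Γ : ∀ {A B} → A ≡ B → A ≈Γ B
≡⇒≈Γ {A} refl = oneO , (oneO , refl) , sym (scale-one A)

≈Γ-sym : ∀ {A B} → A ≈Γ B → B ≈Γ A
≈Γ-sym {A} {B} (u , (v , uv≡1) , A≡uB) = v , (u , trans (*O-comm v u) uv≡1) ,
  sym (trans (cong (scale v) A≡uB) (trans (scale-scale v u B) (trans (cong (λ w → scale w B) (trans (*O-comm v u) uv≡1)) (scale-one B))))

≈Γ-trans : ∀ {A B C} → A ≈Γ B → B ≈Γ C → A ≈Γ C
≈Γ-trans {A} {B} {C} (u , (v , uv≡1) , A≡uB) (u′ , (v′ , u′v′≡1) , B≡u′C) =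
  u *O u′ , (v *O v′ , trans (swap u u′ v v′) (cong₂ _*O_ uv≡1 u′v′≡1)) ,
  trans A≡uB (trans (cong (scale u) B≡u′C) (scale-scale u u′ C))
  where
  swap : ∀ u u′ v v′ → u *O u′ *O (v *O v′) ≡ u *O v *O (u′ *O v′)
  swap = solve-∀ O-ring

·-congˡ : ∀ A {B C} → B ≈Γ C → A · B ≈Γ A · C
·-congˡ A {B} {C} (u , unit , B≡uC) = u , unit , trans (cong (A ·_) B≡uC) (·-scale u A C)

·-congʳ : ∀ {A B} C → A ≈Γ B → A · C ≈Γ B · C
·-congʳ {A} {B} C (u , unit , A≡uB) = u , unit , trans (cong (_· C) A≡uB) (scale-· u B C)

eval-++ : ∀ u v → eval (u ++ v) ≡ eval u · eval v
eval-++ [] v = sym (I₂· (eval v))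
eval-++ (l ∷ u) v = trans (cong (letterMat l ·_) (eval-++ u v)) (sym (·-assoc (letterMat l) (eval u) (eval v)))

basic-sound : ∀ {l r} → BasicRel l r → eval l ≈Γ eval r
basic-sound (cancel⁺ σ) = ≡⇒≈Γ refl
basic-sound (cancel⁺ ν) = ≡⇒≈Γ refl
basic-sound (cancel⁺ τ) = ≡⇒≈Γ refl
basic-sound (cancel⁻ σ) = ≡⇒≈Γ refl
basic-sound (cancel⁻ ν) = ≡⇒≈Γ refl
basic-sound (cancel⁻ τ) = ≡⇒≈Γ refl
-- Only σ² = -I and (σν)² = -ε I need a scalar other than 1.
basic-sound rel1 = -O oneO , (-O oneO , refl) , refl
basic-sound rel2 = ≡⇒≈Γ refl
basic-sound rel3 = -O εO , (-O εinvO , refl) , refl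
basic-sound rel4 = ≡⇒≈Γ refl
basic-sound rel5 = ≡⇒≈Γ refl

sound : ∀ {u v} → u ~ v → eval u ≈Γ eval v
sound (step x y {l} {r} rel) = subst₂ _≈Γ_ (sym (expand l)) (sym (expand r))
  (·-congˡ (eval x) (·-congʳ (eval y) (basic-sound rel)))
  where
  expand : ∀ l → eval (x ++ l ++ y) ≡ eval x · (eval l · eval y)
  expand l = trans (eval-++ x (l ++ y)) (cong (eval x ·_) (eval-++ l y))
sound ~refl = ≡⇒≈Γ refl
sound (~sym p) = ≈Γ-sym (sound p)
sound (~trans p r) = ≈Γ-trans (sound p) (sound r)

det-· : ∀ A B → det (A · B) ≡ det A *O det B
det-· (mat a b c d) (mat e f g h) = identity a b c d e f g h
  where
  identity : ∀ a b c d e f g h →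
    (a *O e +O b *O g) *O (c *O f +O d *O h) +O -O ((a *O f +O b *O h) *O (c *O e +O d *O g))
    ≡ (a *O d +O -O (b *O c)) *O (e *O h +O -O (f *O g))
  identity = solve-∀ O-ring

InΓ̄*-· : ∀ {A B} → InΓ̄* A → InΓ̄* B → InΓ̄* (A · B)
InΓ̄*-· {A} {B} (i , detA) (j , detB) = i + j , trans (det-· A B) (trans (cong₂ _*O_ detA detB) (sym (εpow-+ i j)))

letter∈Γ̄* : ∀ l → InΓ̄* (letterMat l)
letter∈Γ̄* (g⁺ σ) = + 0 , refl
letter∈Γ̄* (g⁺ ν) = + 1 , refl
letter∈Γ̄* (g⁺ τ) = + 0 , refl
letter∈Γ̄* (g⁻ σ) = + 0 , refl
letter∈Γ̄* (g⁻ ν) = - + 1 , refl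
letter∈Γ̄* (g⁻ τ) = + 0 , refl

eval∈Γ̄* : ∀ w → InΓ̄* (eval w)
eval∈Γ̄* []      = + 0 , refl
eval∈Γ̄* (l ∷ w) = InΓ̄*-· {letterMat l} {eval w} (letter∈Γ̄* l) (eval∈Γ̄* w)

-- Translations and dilations as matrices

upper : OF → OF → Mat
upper p x = mat p x zeroO oneO

upper-· : ∀ p x p′ x′ A → upper p x · (upper p′ x′ · A) ≡ upper (p *O p′) (p *O x′ +O x) · A
upper-· p x p′ x′ A = trans (sym (·-assoc (upper p x) (upper p′ x′) A)) (cong (_· A) (mat-cong (e₁ p x p′) (e₂ p x x′) (e₃ p′) (e₄ x′)))
  where
  e₁ : ∀ p x p′ → p *O p′ +O x *O zeroO ≡ p *O p′
  e₁ = solve-∀ O-ring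
  e₂ : ∀ p x x′ → p *O x′ +O x *O oneO ≡ p *O x′ +O x
  e₂ = solve-∀ O-ring
  e₃ : ∀ p′ → zeroO *O p′ +O oneO *O zeroO ≡ zeroO
  e₃ = solve-∀ O-ring
  e₄ : ∀ x′ → zeroO *O x′ +O oneO *O oneO ≡ oneO
  e₄ = solve-∀ O-ring

eval-τ^ : ∀ a w → eval (τ^ a w) ≡ upper oneO (mkO a (+ 0)) · eval w
eval-τ^ (+ zero) w = sym (I₂· (eval w))
eval-τ^ (+ suc k) w = trans (cong (genMat τ ·_) (eval-τ^ (+ k) w)) (trans (upper-· oneO oneO oneO (mkO (+ k) (+ 0)) (eval w))
  (cong (λ y → upper oneO y · eval w) (swap (mkO (+ k) (+ 0)))))
  where
  swap : ∀ x → oneO *O x +O oneO ≡ oneO +O x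
  swap = solve-∀ O-ring
eval-τ^ -[1+ zero ] w = refl
eval-τ^ -[1+ suc k ] w = trans (cong (genMatInv τ ·_) (eval-τ^ -[1+ k ] w)) (trans (upper-· oneO (-O oneO) oneO (mkO -[1+ k ] (+ 0)) (eval w))
  (cong (λ y → upper oneO y · eval w) (swap (mkO -[1+ k ] (+ 0)))))
  where
  swap : ∀ x → oneO *O x +O -O oneO ≡ -O oneO +O x
  swap = solve-∀ O-ring

eval-T : ∀ x w → eval (T x w) ≡ upper oneO x · eval w
eval-T (mkO a b) w = begin
  eval (τ^ a (n ∷ τ^ b (n⁻¹ ∷ w)))
    ≡⟨ eval-τ^ a _ ⟩
  upper oneO A · (upper εO zeroO · eval (τ^ b (n⁻¹ ∷ w)))
    ≡⟨ cong (λ X → upper oneO A · (upper εO zeroO · X)) (eval-τ^ b (n⁻¹ ∷ w)) ⟩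
  upper oneO A · (upper εO zeroO · (upper oneO B · (upper εinvO zeroO · eval w)))
    ≡⟨ cong (λ X → upper oneO A · (upper εO zeroO · X)) (upper-· oneO B εinvO zeroO (eval w)) ⟩
  upper oneO A · (upper εO zeroO · (upper (oneO *O εinvO) (oneO *O zeroO +O B) · eval w))
    ≡⟨ cong (upper oneO A ·_) (upper-· εO zeroO (oneO *O εinvO) (oneO *O zeroO +O B) (eval w)) ⟩
  upper oneO A · (upper (εO *O (oneO *O εinvO)) (εO *O (oneO *O zeroO +O B) +O zeroO) · eval w)
    ≡⟨ upper-· oneO A (εO *O (oneO *O εinvO)) (εO *O (oneO *O zeroO +O B) +O zeroO) (eval w) ⟩
  upper oneO (oneO *O (εO *O (oneO *O zeroO +O B) +O zeroO) +O A) · eval w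
    ≡⟨ cong (λ y → upper oneO y · eval w) (trans (collect A B) split) ⟩
  upper oneO (mkO a b) · eval w ∎
  where
  open ≡-Reasoning
  A B : OF
  A = mkO a (+ 0)
  B = mkO b (+ 0)
  collect : ∀ A B → oneO *O (εO *O (oneO *O zeroO +O B) +O zeroO) +O A ≡ A +O εO *O B
  collect = solve-∀ O-ring
  split : A +O εO *O B ≡ mkO a b
  split = cong₂ mkO
    (solve 2 (λ a b → a :+ (con (+ 0) :* b :+ con (+ 1) :* con (+ 0)) := a) refl a b)
    (solve 2 (λ a b → con (+ 0) :+ (con (+ 0) :* con (+ 0) :+ con (+ 1) :* b :+ con (+ 1) :* con (+ 0)) := b) refl a b)

eval-ν^ : ∀ k w → eval (ν^ k w) ≡ upper (εpow k) zeroO · eval w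
eval-ν^ (+ zero) w = sym (I₂· (eval w))
eval-ν^ (+ suc k) w = trans (cong (genMat ν ·_) (eval-ν^ (+ k) w)) (trans (upper-· εO zeroO (εpow (+ k)) zeroO (eval w)) refl)
eval-ν^ -[1+ zero ] w = refl
eval-ν^ -[1+ suc k ] w = trans (cong (genMatInv ν ·_) (eval-ν^ -[1+ k ] w)) (trans (upper-· εinvO zeroO (εpow -[1+ k ]) zeroO (eval w)) refl)

m21-upper : ∀ p x A → m21 (upper p x · A) ≡ m21 A
m21-upper p x A = identity (m11 A) (m21 A)
  where
  identity : ∀ a c → zeroO *O a +O oneO *O c ≡ c
  identity = solve-∀ O-ring

heightM : Mat → ℕ
heightM A = ∣ N (m21 A) ∣

height : Word → ℕ
height w = heightM (eval w)

heightM-≈ : ∀ {A B} → A ≈Γ B → heightM A ≡ heightM B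
heightM-≈ {A} {B} (c , unit , eq) = trans (cong heightM eq) (∣N∣-scale c (IsUnit⇒∣N∣≡1 c unit) (m21 B))

height-~ : ∀ {u v} → u ~ v → height u ≡ height v
height-~ p = heightM-≈ (sound p)

height-T : ∀ x w → height (T x w) ≡ height w
height-T x w = cong (λ c → ∣ N c ∣) (trans (cong m21 (eval-T x w)) (m21-upper oneO x (eval w)))

height-ν^ : ∀ k w → height (ν^ k w) ≡ height w
height-ν^ k w = cong (λ c → ∣ N c ∣) (trans (cong m21 (eval-ν^ k w)) (m21-upper (εpow k) zeroO (eval w)))

heightM-σ : ∀ A → heightM (genMat σ · A) ≡ ∣ N (m11 A) ∣
heightM-σ A = trans (cong (λ c → ∣ N c ∣) (identity (m11 A) (m21 A))) (cong ∣_∣ (N-neg (m11 A)))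
  where
  identity : ∀ a c → -O oneO *O a +O zeroO *O c ≡ -O a
  identity = solve-∀ O-ring

m11-translate : ∀ x A → m11 (upper oneO x · A) ≡ m11 A +O x *O m21 A
m11-translate x A = identity (m11 A) x (m21 A)
  where
  identity : ∀ a x c → oneO *O a +O x *O c ≡ a +O x *O c
  identity = solve-∀ O-ring

divide : OF → Mat → Mat
divide x A = genMat σ · (upper oneO (-O x) · A)

heightM-divide : ∀ x A → heightM (divide x A) ≡ ∣ N (m11 A +O (-O x) *O m21 A) ∣
heightM-divide x A = trans (heightM-σ (upper oneO (-O x) · A)) (cong (λ a → ∣ N a ∣) (m11-translate (-O x) A))

eval-divide : ∀ x w → eval (s ∷ T (-O x) w) ≡ divide x (eval w)
eval-divide x w = cong (genMat σ ·_) (eval-T (-O x) w)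

-- Division with remainder in the first column

conj : OF → OF
conj (mkO a b) = mkO (a + b) (- b)

*-conj : ∀ c → mkO (N c) (+ 0) ≡ c *O conj c
*-conj (mkO a b) = cong₂ mkO
  (solve 2 (λ a b → Nᵖ a b := a :* (a :+ b) :+ b :* (:- b)) refl a b)
  (solve 2 (λ a b → con (+ 0) := a :* (:- b) :+ b :* (a :+ b) :+ b :* (:- b)) refl a b)

N-conj : ∀ c → N (conj c) ≡ N c
N-conj (mkO a b) = solve 2 (λ a b → Nᵖ (a :+ b) (:- b) := Nᵖ a b) refl a b

module Division (γ : Mat) (h≢0 : heightM γ ≢ 0) where

  private
    a c : OF
    a = m11 γ
    c = m21 γ

  open Approximation (N c) (λ Nc≡0 → h≢0 (cong ∣_∣ Nc≡0)) public

  -- a / c = numerator / N c.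
  numerator : OF
  numerator = a *O conj c

  -- Multiplying a - x c by the conjugate of c gives the quotient the rational integer denominator
  -- `N c`. Both sides of the height comparison thereby acquire the same factor |N c|.
  ∣N-remainder∣ : ∀ x → ∣ N (remainder numerator x) ∣ ≡ heightM (divide x γ) ℕ.* heightM γ
  ∣N-remainder∣ x = begin
    ∣ N (remainder numerator x) ∣                       ≡⟨ cong (λ k → ∣ N (a *O conj c +O -O (k *O x)) ∣) (*-conj c) ⟩
    ∣ N (a *O conj c +O -O (c *O conj c *O x)) ∣       ≡⟨ cong (λ z → ∣ N z ∣) (factor a c (conj c) x) ⟩
    ∣ N ((a +O (-O x) *O c) *O conj c) ∣               ≡⟨ ∣N-*∣ (a +O (-O x) *O c) (conj c) ⟩
    ∣ N (a +O (-O x) *O c) ∣ ℕ.* ∣ N (conj c) ∣        ≡⟨ cong₂ ℕ._*_ (sym (heightM-divide x γ)) (cong ∣_∣ (N-conj c)) ⟩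
    heightM (divide x γ) ℕ.* heightM γ                 ∎
    where
    open ≡-Reasoning
    factor : ∀ a c c′ x → a *O c′ +O -O (c *O c′ *O x) ≡ (a +O (-O x) *O c) *O c′
    factor = solve-∀ O-ring

  ∣M∣ : ∣ M ∣ ≡ heightM γ ℕ.* heightM γ
  ∣M∣ = ℤ.abs-* (N c) (N c)

  close⇒lower : ∀ x → Close numerator x → heightM (divide x γ) ℕ.< heightM γ
  close⇒lower x cl = ℕ.*-cancelʳ-< (heightM γ) (heightM (divide x γ)) (heightM γ) (subst₂ ℕ._<_ (∣N-remainder∣ x) ∣M∣ cl)

  lower⇒close : ∀ x → heightM (divide x γ) ℕ.< heightM γ → Close numerator x
  lower⇒close x lt = subst₂ ℕ._<_ (sym (∣N-remainder∣ x)) (sym ∣M∣) (ℕ.*-monoˡ-< (heightM γ) {{ℕ.≢-nonZero h≢0}} lt)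

-- Words along which the height decreases

-- Formulated up to `~`, hence a property of the element of the presented group. A leading
-- translation is allowed at every stage because it leaves the height unchanged.
data Descending : Word → Set where
  base    : ∀ {w} x k → w ~ T x (ν^ k []) → Descending w
  descend : ∀ {w} x v → w ~ T x (s ∷ v) → Descending v → height v ℕ.< height w → Descending w

Descending-~ : ∀ {u v} → u ~ v → Descending v → Descending u
Descending-~ p (base x k r)         = base x k (~trans p r)
Descending-~ p (descend x v r d lt) = descend x v (~trans p r) d (subst (height v ℕ.<_) (sym (height-~ p)) lt)

Descending-T : ∀ x {w} → Descending w → Descending (T x w)
Descending-T x (base y k r) = base (x +O y) k (~trans (T-cong x r) (T-+ x y (ν^ k [])))
Descending-T x {w} (descend y v r d lt) = descend (x +O y) v (~trans (T-cong x r) (T-+ x y (s ∷ v))) d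
  (subst (height v ℕ.<_) (sym (height-T x w)) lt)

Descending-ν^ : ∀ j {w} → Descending w → Descending (ν^ j w)
Descending-ν^ j (base x k r) = base (εpow j *O x) (j + k) (~trans (pow-cong (letter ν) j r)
  (~trans (ν^-T j x (ν^ k [])) (T-cong (εpow j *O x) (~sym (pow-+ (letter ν) j k [])))))
Descending-ν^ j {w} (descend x v r d lt) = descend (εpow j *O x) (ν^ (- j) v)
  (~trans (pow-cong (letter ν) j r) (~trans (ν^-T j x (s ∷ v)) (T-cong (εpow j *O x) (~trans
    (subst (λ i → ν^ j (s ∷ v) ~ ν^ i (s ∷ v)) (sym (ℤ.neg-involutive j)) ~refl) (~sym (σ-ν^ (- j) v))))))
  (Descending-ν^ (- j) d)
  (subst₂ ℕ._<_ (sym (height-ν^ (- j) v)) (sym (height-ν^ j w)) lt)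

Descending-σ-up : ∀ {w} → Descending w → height w ℕ.< height (s ∷ w) → Descending (s ∷ w)
Descending-σ-up {w} d lt = descend zeroO w (~sym (T-zero (s ∷ w))) d lt

-- Existence of descending words

T-≈ : ∀ x u v → eval u ≈Γ eval v → eval (T x u) ≈Γ eval (T x v)
T-≈ x u v p = subst₂ _≈Γ_ (sym (eval-T x u)) (sym (eval-T x v)) (·-congˡ (upper oneO x) p)

σ-≈ : ∀ u v → eval u ≈Γ eval v → eval (s ∷ u) ≈Γ eval (s ∷ v)
σ-≈ u v = ·-congˡ (genMat σ)

eval-base : ∀ x k → eval (T x (ν^ k [])) ≡ upper (εpow k) x
eval-base x k = trans (eval-T x (ν^ k [])) (trans (cong (upper oneO x ·_) (eval-ν^ k []))
    (trans (upper-· oneO x (εpow k) zeroO I₂) (mat-cong (entry₁₁ (εpow k) x) (entry₁₂ (εpow k) x) refl refl)))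
  where
  entry₁₁ : ∀ p x → oneO *O p *O oneO +O (oneO *O zeroO +O x) *O zeroO ≡ p
  entry₁₁ = solve-∀ O-ring
  entry₁₂ : ∀ p x → oneO *O p *O zeroO +O (oneO *O zeroO +O x) *O oneO ≡ x
  entry₁₂ = solve-∀ O-ring

undo-divide : ∀ x γ → upper oneO x · (genMat σ · divide x γ) ≈Γ γ
undo-divide x γ = -O oneO , (-O oneO , refl) ,
  trans (cong (upper oneO x ·_) (trans (σσ (upper oneO (-O x) · γ)) (sym (·-scale (-O oneO) (upper oneO (-O x)) γ))))
        (trans (upper-· oneO x oneO (-O x) (scale (-O oneO) γ)) (trans (cong (λ y → upper oneO y · scale (-O oneO) γ) (cancel x)) (I₂· _)))
  where
  σσ : ∀ A → genMat σ · (genMat σ · A) ≡ scale (-O oneO) A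
  σσ A = trans (sym (·-assoc (genMat σ) (genMat σ) A)) (trans (scale-· (-O oneO) I₂ A) (cong (scale (-O oneO)) (I₂· A)))
  cancel : ∀ x → oneO *O (-O x) +O x ≡ zeroO
  cancel = solve-∀ O-ring

-- Dividing by the unit d leaves the diagonal entry a / d = (a d) / d². The sign of d disappears in
-- d², so a / d is a power of ε exactly because the determinant is one.
upper-represented : ∀ γ → m21 γ ≡ zeroO → InΓ̄* γ → Σ Word λ w → Descending w × γ ≈Γ eval w
upper-represented (mat a b _ d) refl (i , det≡) = represent (unit-form d ∣Nd∣≡1)
  where
  ad≡ : a *O d ≡ εpow i
  ad≡ = trans (identity a b d) det≡
    where
    identity : ∀ a b d → a *O d ≡ a *O d +O -O (b *O zeroO)
    identity = solve-∀ O-ring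
  ∣Nd∣≡1 : ∣ N d ∣ ≡ 1
  ∣Nd∣≡1 = ℕ.m*n≡1⇒n≡1 ∣ N a ∣ ∣ N d ∣ (trans (sym (∣N-*∣ a d)) (trans (cong (λ z → ∣ N z ∣) ad≡) (∣N-εpow∣ i)))
  represent : (Σ OF λ e → Σ ℤ λ k → IsSign e × d ≡ εpow k *O e) → Σ Word λ w → Descending w × mat a b zeroO d ≈Γ eval w
  represent (e , k , sign , d≡) = T (b *O d⁻¹) (ν^ j []) , base (b *O d⁻¹) j ~refl , d , (d⁻¹ , dd⁻¹≡1) ,
      sym (trans (cong (scale d) (eval-base (b *O d⁻¹) j)) (mat-cong entry₁₁ entry₁₂ (*zero d) (*O-identityʳ d)))
    where
    d⁻¹ : OF
    d⁻¹ = εpow (- k) *O e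
    j : ℤ
    j = i + (- k + - k)
    ee≡1 : e *O e ≡ oneO
    ee≡1 = square sign
      where
      square : ∀ {e} → IsSign e → e *O e ≡ oneO
      square (inj₁ refl) = refl
      square (inj₂ refl) = refl
    dd⁻¹≡1 : d *O d⁻¹ ≡ oneO
    dd⁻¹≡1 = trans (cong (_*O d⁻¹) d≡) (trans (swap (εpow k) e (εpow (- k))) (cong₂ _*O_ (εpow-inverse k) ee≡1))
      where
      swap : ∀ p e r → p *O e *O (r *O e) ≡ p *O r *O (e *O e)
      swap = solve-∀ O-ring
    d⁻¹d⁻¹≡ : εpow (- k + - k) ≡ d⁻¹ *O d⁻¹
    d⁻¹d⁻¹≡ = trans (εpow-+ (- k) (- k)) (trans (sym (*O-identityʳ (εpow (- k) *O εpow (- k))))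
        (trans (cong (εpow (- k) *O εpow (- k) *O_) (sym ee≡1)) (swap (εpow (- k)) e)))
      where
      swap : ∀ r e → r *O r *O (e *O e) ≡ r *O e *O (r *O e)
      swap = solve-∀ O-ring
    *zero : ∀ x → x *O zeroO ≡ zeroO
    *zero = solve-∀ O-ring
    entry₁₁ : d *O εpow j ≡ a
    entry₁₁ = trans (cong (d *O_) (trans (εpow-+ i (- k + - k)) (cong₂ _*O_ (sym ad≡) d⁻¹d⁻¹≡)))
        (trans (swap a d d⁻¹) (trans (cong₂ (λ x y → a *O (x *O y)) dd⁻¹≡1 dd⁻¹≡1) (*O-identityʳ a)))
      where
      swap : ∀ a d r → d *O (a *O d *O (r *O r)) ≡ a *O (d *O r *O (d *O r))
      swap = solve-∀ O-ring
    entry₁₂ : d *O (b *O d⁻¹) ≡ b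
    entry₁₂ = trans (swap b d d⁻¹) (trans (cong (b *O_) dd⁻¹≡1) (*O-identityʳ b))
      where
      swap : ∀ b d r → d *O (b *O r) ≡ b *O (d *O r)
      swap = solve-∀ O-ring

represented : ∀ γ → InΓ̄* γ → Σ Word λ w → Descending w × γ ≈Γ eval w
represented γ = go γ (<-wellFounded (heightM γ))
  where
  go : ∀ γ → Acc ℕ._<_ (heightM γ) → InΓ̄* γ → Σ Word λ w → Descending w × γ ≈Γ eval w
  go γ (acc rs) γ∈Γ̄* = cases (heightM γ ℕ.≟ 0)
    where
    cases : Dec (heightM γ ≡ 0) → Σ Word λ w → Descending w × γ ≈Γ eval w
    cases (yes h≡0) = upper-represented γ (N≡0⇒≡0 (m21 γ) (ℤ.∣i∣≡0⇒i≡0 h≡0)) γ∈Γ̄*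
    cases (no h≢0) = extend (go (divide x γ) (rs lower) divide∈Γ̄*)
      where
      open Division γ h≢0
      x : OF
      x = round numerator
      lower : heightM (divide x γ) ℕ.< heightM γ
      lower = close⇒lower x (round-close numerator)
      divide∈Γ̄* : InΓ̄* (divide x γ)
      divide∈Γ̄* = InΓ̄*-· {genMat σ} {upper oneO (-O x) · γ} (+ 0 , refl)
        (InΓ̄*-· {upper oneO (-O x)} {γ} (+ 0 , det-translation (-O x)) γ∈Γ̄*)
        where
        det-translation : ∀ x → oneO *O oneO +O -O (x *O zeroO) ≡ oneO
        det-translation = solve-∀ O-ring
      extend : (Σ Word λ w → Descending w × divide x γ ≈Γ eval w) → Σ Word λ w → Descending w × γ ≈Γ eval w
      extend (w , d , ≈w) = T x (s ∷ w) ,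
          descend x w ~refl d (subst₂ ℕ._<_ (heightM-≈ ≈w) (heightM-≈ γ≈) lower) , γ≈
        where
        γ≈ : γ ≈Γ eval (T x (s ∷ w))
        γ≈ = ≈Γ-trans (≈Γ-sym (undo-divide x γ)) (subst (_ ≈Γ_) (sym (eval-T x (s ∷ w)))
          (·-congˡ (upper oneO x) (·-congˡ (genMat σ) ≈w)))

-- Uniqueness of descending words

divide-cancel : ∀ x {u v} → u ~ T x (s ∷ v) → s ∷ T (-O x) u ~ v
divide-cancel x {u} {v} p = ~trans (∷-cong s (~trans (T-cong (-O x) p) (T-cancel′ x (s ∷ v)))) (σ² v)

divide-restore : ∀ x w v → eval (s ∷ T (-O x) w) ≈Γ eval v → eval w ≈Γ eval (T x (s ∷ v))
divide-restore x w v p = ≈Γ-trans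
  (sound (~sym (~trans (T-cong x (σ² (T (-O x) w))) (T-cancel x w))))
  (T-≈ x (s ∷ s ∷ T (-O x) w) (s ∷ v) (σ-≈ (s ∷ T (-O x) w) v p))

column≢0 : ∀ w → ¬ (m11 (eval w) ≡ zeroO × m21 (eval w) ≡ zeroO)
column≢0 w (a≡0 , c≡0) = 0≢1 (trans (sym (cong (λ z → ∣ N z ∣) det≡0)) (trans (cong (λ z → ∣ N z ∣) (proj₂ (eval∈Γ̄* w))) (∣N-εpow∣ (proj₁ (eval∈Γ̄* w)))))
  where
  0≢1 : 0 ≢ 1
  0≢1 ()
  identity : ∀ b d → zeroO *O d +O -O (b *O zeroO) ≡ zeroO
  identity = solve-∀ O-ring
  det≡0 : det (eval w) ≡ zeroO
  det≡0 = trans (cong₂ (λ a c → a *O m22 (eval w) +O -O (m12 (eval w) *O c)) a≡0 c≡0) (identity (m12 (eval w)) (m22 (eval w)))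

Unique : ℕ → Set
Unique h = ∀ u v → Descending u → Descending v → height u ≡ h → eval u ≈Γ eval v → u ~ v

represent-word : ∀ w → Σ Word λ v → Descending v × eval w ≈Γ eval v
represent-word w = represented (eval w) (eval∈Γ̄* w)

-- If w and σ w have equal height, a common neighbour of smaller height completes a triangle.
Descending-σ : ∀ w → Unique (height w) → Descending w → Descending (s ∷ w)
Descending-σ w unique dw = cases (ℕ.<-cmp (height w) (height (s ∷ w)))
  where
  cases : Tri (height w ℕ.< height (s ∷ w)) (height w ≡ height (s ∷ w)) (height (s ∷ w) ℕ.< height w) → Descending (s ∷ w)
  cases (tri< lt _ _) = Descending-σ-up dw lt
  -- If `v` is a descending word for the lower matrix of σ w, then σ v is a descending word for that
  -- of w. Uniqueness identifies it with `w`, and σ w is equivalent to `v`.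
  cases (tri> _ _ gt) = from (represent-word (s ∷ w))
    where
    from : (Σ Word λ v → Descending v × eval (s ∷ w) ≈Γ eval v) → Descending (s ∷ w)
    from (v , dv , σw≈v) = Descending-~ (~trans (∷-cong s w~σv) (σ² v)) dv
      where
      w≈σv : eval w ≈Γ eval (s ∷ v)
      w≈σv = ≈Γ-trans (≈Γ-sym (sound (σ² w))) (σ-≈ (s ∷ w) v σw≈v)
      w~σv : w ~ s ∷ v
      w~σv = unique w (s ∷ v) dw
        (Descending-σ-up dv (subst₂ ℕ._<_ (heightM-≈ σw≈v) (heightM-≈ w≈σv) gt)) refl w≈σv
  -- Equal heights mean |N (a / c)| = 1, so the quotient 0 lies on the boundary and some close
  -- quotient differs from it by a unit.
  cases (tri≈ _ eq _) = triangle (boundary⇒linked numerator zeroO boundary)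
    where
    ∣Na∣≡ : ∣ N (m11 (eval w)) ∣ ≡ height w
    ∣Na∣≡ = trans (sym (heightM-σ (eval w))) (sym eq)
    h≢0 : height w ≢ 0
    h≢0 h≡0 = column≢0 w (N≡0⇒≡0 (m11 (eval w)) (ℤ.∣i∣≡0⇒i≡0 (trans ∣Na∣≡ h≡0)) , N≡0⇒≡0 (m21 (eval w)) (ℤ.∣i∣≡0⇒i≡0 h≡0))
    open Division (eval w) h≢0
    boundary : ∣ N (remainder numerator zeroO) ∣ ≡ ∣ M ∣
    boundary = trans (∣N-remainder∣ zeroO) (trans (cong (ℕ._* height w)
        (trans (heightM-divide zeroO (eval w)) (trans (cong (λ z → ∣ N z ∣) (identity (m11 (eval w)) (m21 (eval w)))) ∣Na∣≡))) (sym ∣M∣))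
      where
      identity : ∀ a c → a +O (-O zeroO) *O c ≡ a
      identity = solve-∀ O-ring
    triangle : (Σ OF λ y → Close numerator y × ∣ N (Δ zeroO y) ∣ ≡ 1) → Descending (s ∷ w)
    triangle (y , close , unit) = from (represent-word (s ∷ T (-O y) w)) (σTσ-unit y ∣Ny∣≡1)
      where
      ∣Ny∣≡1 : ∣ N y ∣ ≡ 1
      ∣Ny∣≡1 = trans (sym (cong ∣_∣ (N-neg y))) (trans (cong (λ z → ∣ N z ∣) (identity y)) unit)
        where
        identity : ∀ y → -O y ≡ zeroO +O -O y
        identity = solve-∀ O-ring
      from : (Σ Word λ v → Descending v × eval (s ∷ T (-O y) w) ≈Γ eval v)
        → (Σ OF λ x → Σ ℤ λ k → Σ OF λ z → ∀ v → s ∷ T y (s ∷ v) ~ T x (ν^ k (s ∷ T z v))) → Descending (s ∷ w)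
      from (v , dv , ≈v) (x , k , z , rel) = Descending-~ σw~ (Descending-T x (Descending-ν^ k
          (Descending-σ-up (Descending-T z dv) (subst₂ ℕ._<_ (sym (height-T z v)) h≡ v<w))))
        where
        v<w : height v ℕ.< height w
        v<w = subst (ℕ._< height w) (trans (cong heightM (sym (eval-divide y w))) (heightM-≈ ≈v)) (close⇒lower y close)
        w≈ : eval w ≈Γ eval (T y (s ∷ v))
        w≈ = divide-restore y w v ≈v
        w~ : w ~ T y (s ∷ v)
        w~ = unique w (T y (s ∷ v)) dw (descend y v ~refl dv (subst (height v ℕ.<_) (heightM-≈ w≈) v<w)) refl w≈
        σw~ : s ∷ w ~ T x (ν^ k (s ∷ T z v))
        σw~ = ~trans (∷-cong s w~) (rel v)
        h≡ : height w ≡ height (s ∷ T z v)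
        h≡ = trans eq (trans (height-~ σw~) (trans (height-T x (ν^ k (s ∷ T z v))) (height-ν^ k (s ∷ T z v))))

module _ (h : ℕ) (unique-below : ∀ {m} → m ℕ.< h → Unique m) (u : Word) (height≡ : height u ≡ h) (h≢0 : height u ≢ 0) where

  open Division (eval u) h≢0

  Neighbour : OF → Word → Set
  Neighbour x v = Descending v × eval v ≈Γ eval (s ∷ T (-O x) u) × height v ℕ.< h

  close⇒neighbour : ∀ x → Close numerator x → Σ Word (Neighbour x)
  close⇒neighbour x close = from (represent-word (s ∷ T (-O x) u))
    where
    from : (Σ Word λ v → Descending v × eval (s ∷ T (-O x) u) ≈Γ eval v) → Σ Word (Neighbour x)
    from (v , dv , ≈v) = v , dv , ≈Γ-sym ≈v ,
      subst₂ ℕ._<_ (trans (cong heightM (sym (eval-divide x u))) (heightM-≈ ≈v)) height≡ (close⇒lower x close)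

  -- Two neighbours of u that differ by a unit translation span a triangle with u.
  linked-neighbours : ∀ x y v v′ → ∣ N (Δ x y) ∣ ≡ 1 → Neighbour x v → Neighbour y v′ → T x (s ∷ v) ~ T y (s ∷ v′)
  linked-neighbours x y v v′ unit (dv , ≈v , v<h) (dv′ , ≈v′ , v′<h) = from (σTσ-unit e ∣Ne∣≡1)
    where
    e : OF
    e = Δ y x
    ∣Ne∣≡1 : ∣ N e ∣ ≡ 1
    ∣Ne∣≡1 = trans (cong (λ z → ∣ N z ∣) (identity x y)) (trans (cong ∣_∣ (N-neg (Δ x y))) unit)
      where
      identity : ∀ x y → y +O -O x ≡ -O (x +O -O y)
      identity = solve-∀ O-ring
    v≈ : eval v ≈Γ eval (s ∷ T e (s ∷ v′))
    v≈ = ≈Γ-trans ≈v (≈Γ-sym (≈Γ-trans (σ-≈ (T e (s ∷ v′)) (T e (s ∷ s ∷ T (-O y) u)) (T-≈ e (s ∷ v′) (s ∷ s ∷ T (-O y) u) (σ-≈ v′ (s ∷ T (-O y) u) ≈v′))) (sound (∷-cong s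
        (~trans (T-cong e (σ² (T (-O y) u))) (T-+≡ e (-O y) (identity x y) u))))))
      where
      identity : ∀ x y → y +O -O x +O -O y ≡ -O x
      identity = solve-∀ O-ring
    from : (Σ OF λ x′ → Σ ℤ λ k → Σ OF λ z → ∀ w → s ∷ T e (s ∷ w) ~ T x′ (ν^ k (s ∷ T z w))) → T x (s ∷ v) ~ T y (s ∷ v′)
    from (x′ , k , z , rel) = ~trans (T-cong x (~trans (∷-cong s v~) (σ² (T e (s ∷ v′))))) (T-+≡ x e (identity x y) (s ∷ v′))
      where
      identity : ∀ x y → x +O (y +O -O x) ≡ y
      identity = solve-∀ O-ring
      r : Word
      r = T x′ (ν^ k (s ∷ T z v′))
      v≈r : eval v ≈Γ eval r
      v≈r = ≈Γ-trans v≈ (sound (rel v′))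
      -- σ may raise, keep or lower the height of `T z v′`. `Descending-σ` covers all three cases
      -- and needs uniqueness only at the height of `v′`, which is below `h`.
      dr : Descending r
      dr = Descending-T x′ (Descending-ν^ k (Descending-σ (T z v′)
        (unique-below (subst (ℕ._< h) (sym (height-T z v′)) v′<h)) (Descending-T z dv′)))
      v~ : v ~ s ∷ T e (s ∷ v′)
      v~ = ~trans (unique-below v<h v r dv dr refl v≈r) (~sym (rel v′))

  -- The words at the two ends are arbitrary, so even the trivial path uses uniqueness below `h`. At
  -- an interior point any descending word for the lower matrix will do.
  connected-neighbours : ∀ {x y} → Connected numerator x y → ∀ v v′ → Neighbour x v → Neighbour y v′ → T x (s ∷ v) ~ T y (s ∷ v′)
  connected-neighbours (here {x}) v v′ (dv , ≈v , v<h) (dv′ , ≈v′ , _) =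
    T-cong x (∷-cong s (unique-below v<h v v′ dv dv′ refl (≈Γ-trans ≈v (≈Γ-sym ≈v′))))
  connected-neighbours (link {x} {y} unit) v v′ nv nv′ = linked-neighbours x y v v′ unit nv nv′
  connected-neighbours (back p) v v′ nv nv′ = ~sym (connected-neighbours p v′ v nv′ nv)
  connected-neighbours (via {y = y} p close r) v v′ nv nv′ = through (close⇒neighbour y close)
    where
    through : Σ Word (Neighbour y) → _
    through (w , nw) = ~trans (connected-neighbours p v w nv nw) (connected-neighbours r w v′ nw nv′)

unique : ∀ h → Unique h
unique h = go h (<-wellFounded h)
  where
  height-base : ∀ {w} x k → w ~ T x (ν^ k []) → height w ≡ 0
  height-base x k p = trans (height-~ p) (trans (height-T x (ν^ k [])) (height-ν^ k []))

  -- Both lower right entries are 1, which forces the scalar to be 1. The translation parts then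
  -- agree, and so do the exponents because ε has infinite order.
  base-unique : ∀ x k y j → eval (T x (ν^ k [])) ≈Γ eval (T y (ν^ j [])) → T x (ν^ k []) ~ T y (ν^ j [])
  base-unique x k y j p = equal (subst₂ _≈Γ_ (eval-base x k) (eval-base y j) p)
    where
    equal : upper (εpow k) x ≈Γ upper (εpow j) y → T x (ν^ k []) ~ T y (ν^ j [])
    equal (c , _ , eq) = subst₂ (λ y j → T x (ν^ k []) ~ T y (ν^ j []))
        (trans (cong m12 eq) (trans (cong (_*O y) c≡1) (*O-identityˡ y)))
        (εpow-injective k j (trans (cong m11 eq) (trans (cong (_*O εpow j) c≡1) (*O-identityˡ (εpow j)))))
        ~refl
      where
      c≡1 : c ≡ oneO
      c≡1 = trans (sym (*O-identityʳ c)) (sym (cong m22 eq))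

  go : ∀ h → Acc ℕ._<_ h → Unique h
  go h (acc rs) u v (base x k p) (base y j r) _ u≈v =
    ~trans p (~trans (base-unique x k y j (≈Γ-trans (sound (~sym p)) (≈Γ-trans u≈v (sound r)))) (~sym r))
  go h (acc rs) u v (base x k p) (descend y v′ r dv′ v′<v) _ u≈v =
    ⊥-elim (ℕ.n≮0 (subst (height v′ ℕ.<_) (trans (sym (heightM-≈ u≈v)) (height-base x k p)) v′<v))
  go h (acc rs) u v (descend x u′ p du′ u′<u) (base y j r) _ u≈v =
    ⊥-elim (ℕ.n≮0 (subst (height u′ ℕ.<_) (trans (heightM-≈ u≈v) (height-base y j r)) u′<u))
  go h (acc rs) u v (descend x u′ p du′ u′<u) (descend y v′ r dv′ v′<v) height≡ u≈v =
    -- The two words supply neighbours of one and the same matrix: `v` is replaced by `u`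
    -- throughout, which is legitimate since their values agree up to a unit scalar.
    ~trans p (~trans (connected-neighbours h (λ m<h → go _ (rs m<h)) u height≡ h≢0 connected u′ v′ nu′ nv′) (~sym r))
    where
    h≢0 : height u ≢ 0
    h≢0 h≡0 = ℕ.n≮0 (subst (height u′ ℕ.<_) h≡0 u′<u)
    open Division (eval u) h≢0
    v′<u : height v′ ℕ.< height u
    v′<u = subst (height v′ ℕ.<_) (sym (heightM-≈ u≈v)) v′<v
    u′≈ : eval u′ ≈Γ eval (s ∷ T (-O x) u)
    u′≈ = sound (~sym (divide-cancel x p))
    v′≈ : eval v′ ≈Γ eval (s ∷ T (-O y) u)
    v′≈ = ≈Γ-trans (sound (~sym (divide-cancel y r)))
      (σ-≈ (T (-O y) v) (T (-O y) u) (T-≈ (-O y) v u (≈Γ-sym u≈v)))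
    nu′ : Neighbour h (λ m<h → go _ (rs m<h)) u height≡ h≢0 x u′
    nu′ = du′ , u′≈ , subst (height u′ ℕ.<_) height≡ u′<u
    nv′ : Neighbour h (λ m<h → go _ (rs m<h)) u height≡ h≢0 y v′
    nv′ = dv′ , v′≈ , subst (height v′ ℕ.<_) height≡ v′<u
    close : ∀ x w → eval w ≈Γ eval (s ∷ T (-O x) u) → height w ℕ.< height u → Close numerator x
    close x w w≈ w<u = lower⇒close x (subst (ℕ._< height u) (trans (heightM-≈ w≈) (cong heightM (eval-divide x u))) w<u)
    connected : Connected numerator x y
    connected = close⇒connected numerator x y (close x u′ u′≈ u′<u) (close y v′ v′≈ v′<u)

-- This extends uniqueness to all pairs of words. Only the letter σ requires an argument, since ν
-- and τ are absorbed into the descending form.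
all-descending : ∀ w → Descending w
all-descending [] = base zeroO (+ 0) (~sym (T-zero []))
all-descending (g⁺ σ ∷ w) = Descending-σ w (unique (height w)) (all-descending w)
all-descending (g⁻ σ ∷ w) = Descending-~ (~trans (∷-cong s⁻¹ (~sym (σ² w))) (step [] (s ∷ w) (cancel⁻ σ)))
  (Descending-σ w (unique (height w)) (all-descending w))
all-descending (g⁺ ν ∷ w) = Descending-ν^ (+ 1) (all-descending w)
all-descending (g⁻ ν ∷ w) = Descending-ν^ (- + 1) (all-descending w)
all-descending (g⁺ τ ∷ w) = Descending-~ (~sym (T-one w)) (Descending-T oneO (all-descending w))
all-descending (g⁻ τ ∷ w) = Descending-~ (~sym (T-minus-one w)) (Descending-T (-O oneO) (all-descending w))

theorem6p1 : ((γ : Mat) → InΓ̄* γ → Σ Word (λ w → γ ≈Γ eval w))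
    × ((u v : Word) → u ~ v → eval u ≈Γ eval v)
    × ((u v : Word) → eval u ≈Γ eval v → u ~ v)
theorem6p1 =
    (λ γ γ∈Γ̄* → let (w , _ , γ≈w) = represented γ γ∈Γ̄* in w , γ≈w)
  , (λ u v → sound)
  , (λ u v → unique (height u) u v (all-descending u) (all-descending v) refl)
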